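{- Let $k\ge 2$. For all sufficiently large $n$, the complex $\Delta^{2k-1}_n$ admits exactly two automorphisms: the identity and the automorphism induced by the involution $i\mapsto -i$ of $V_n$. (An automorphism is a bijection $\phi:V_n\to V_n$ such that $\sigma\in\Delta^{2k-1}_n$ if and only if $\phi(\sigma)\in\Delta^{2k-1}_n$.)
   Context: Simplicial complexes are finite abstract simplicial complexes. For a finite set $A$, $\overline{A}$ is the simplex of all subsets of $A$. $V_n=\{\pm1,\dots,\pm n\}$. For a set $\sigma$ of integers, $-\sigma=\{ -v:v\in\sigma\}$; for a complex $\Gamma$, $-\Gamma=\{ -\sigma:\sigma\in\Gamma\}$. The join is $\Gamma*\Gamma'=\{\sigma\cup\tau:\sigma\in\Gamma,\tau\in\Gamma'\}$ (disjoint vertex sets); $\Gamma*v:=\Gamma*\overline{\{v\}}$. A path $(v_1,\dots,v_m)$ is the 1-dimensional complex with edges $\{v_j,v_{j+1}\}$ (a cycle if $v_m=v_1$). $\partial C^*_m$ is the complex of all subsets of $V_m$ containing no pair $\{j,-j\}$. For a pure complex $\Delta$ and pure full-dimensional subcomplex $\Gamma$, $\Delta\setminus\Gamma$ is the subcomplex generated by the facets of $\Delta$ not in $\Gamma$. $\partial B$ is the boundary complex of a combinatorial ball $B$. The complexes $\Delta^d_n$ ($d\ge1$, $n\ge d+1$) and $B^{d,i}_n$ are defined recursively: $\Delta^1_n$ is the cycle $(1,2,\dots,n,-1,\dots,-n,1)$; $\Delta^d_{d+1}=\partial C^*_{d+1}$; $B^{d,j}_n=\emptyset$ for $j<0$;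 $B^{1,0}_n=\overline{\{ -1,n\}}$; for $k\ge1$, $n\ge2k$: $B^{2k-1,k}_n=\Delta^{2k-1}_n\setminus B^{2k-1,k-1}_n$; for $d\ge2$, $n\ge d+1$, $i\le\lfloor d/2\rfloor$: $B^{d,i}_n=(B^{d-1,i}_{n-1}*n)\cup((-B^{d-1,i-1}_{n-1})*(-n))$; $\Delta^d_{n+1}$ is obtained from $\Delta^d_n$ by replacing $B=B^{d,\lceil d/2\rceil-1}_n$ with $\partial B*(n+1)$ and $-B$ with $\partial(-B)*(-n-1)$. (These are known to be well defined; $\Delta^d_n$ is a combinatorial $d$-sphere on $V_n$ invariant under $v\mapsto-v$.) -}

module Defs where

open import Data.Bool using (Bool; true; false; not; _∧_; if_then_else_)
open import Data.Nat using (ℕ; zero; suc; _+_; _≤ᵇ_; _≡ᵇ_; ⌈_/2⌉; _∸_)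
open import Data.Integer using (ℤ; +_; -_)
open import Data.Integer.Properties using () renaming (_≟_ to _≟ℤ_)
open import Data.List using (List; []; _∷_; _++_; map; filterᵇ; concatMap; length; applyUpTo; take)
open import Data.Bool.ListAction using (all; any)
open import Data.List.Relation.Unary.Any using (Any)
open import Data.List.Relation.Unary.All using (All)
open import Data.List.Membership.Propositional using (_∈_)
open import Data.Fin using (Fin; toℕ)
open import Data.Product using (_×_; _,_)
open import Function using (_∘_)
open import Function.Bundles using (_⇔_)
open import Function.Definitions using (Bijective)
open import Relation.Nullary.Decidable using (does)
open import Relation.Binary.PropositionalEquality using (_≡_)

-- Finite simplicial complexes, represented by a list of generating faces
-- (facets).  Vertices are integers; a face is a finite set of integers,
-- represented by a list.  The complex generated by a list of faces is the
-- set of all subsets of its members.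

Face : Set
Face = List ℤ

Complex : Set
Complex = List Face

_∈C_ : List ℤ → Complex → Set
σ ∈C Δ = Any (λ F → All (λ v → v ∈ F) σ) Δ

_==ℤ_ : ℤ → ℤ → Bool
x ==ℤ y = does (x ≟ℤ y)

_⊆ᵇ_ : Face → Face → Bool
σ ⊆ᵇ F = all (λ v → any (v ==ℤ_) F) σ

_∈ᵇ_ : Face → Complex → Bool
σ ∈ᵇ Δ = any (σ ⊆ᵇ_) Δ

_≈ᵇ_ : Face → Face → Bool
σ ≈ᵇ τ = (σ ⊆ᵇ τ) ∧ (τ ⊆ᵇ σ)

dedup : Complex → Complex
dedup [] = []
dedup (F ∷ Fs) = F ∷ filterᵇ (λ G → not (F ≈ᵇ G)) (dedup Fs)

count : (Face → Bool) → Complex → ℕ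
count p [] = 0
count p (F ∷ Fs) = if p F then suc (count p Fs) else count p Fs

removeEach : Face → List Face
removeEach [] = []
removeEach (x ∷ xs) = xs ∷ map (x ∷_) (removeEach xs)

_∖_ : Complex → Complex → Complex
Δ ∖ Γ = filterᵇ (λ F → not (F ∈ᵇ Γ)) Δ

_*v_ : Complex → ℤ → Complex
Γ *v v = map (v ∷_) Γ

negC : Complex → Complex
negC = map (map -_)

-- boundary of a combinatorial ball B (pure, of dimension d):
-- the complex generated by the (d-1)-faces contained in exactly one facet
∂ : Complex → Complex
∂ B = filterᵇ (λ τ → count (τ ⊆ᵇ_) Fs ≡ᵇ 1) (concatMap removeEach Fs)
  where Fs = dedup B

path : List ℤ → Complex
path (x ∷ y ∷ xs) = (x ∷ y ∷ []) ∷ path (y ∷ xs)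
path _ = []

cycle : ℕ → Complex
cycle n = path (seq ++ take 1 seq)
  where
  pos = applyUpTo (λ j → + suc j) n
  seq = pos ++ map -_ pos

crossBd : ℕ → Complex
crossBd zero = [] ∷ []
crossBd (suc m) = concatMap (λ F → (+ suc m ∷ F) ∷ (- (+ suc m) ∷ F) ∷ []) (crossBd m)

isOdd : ℕ → Bool
isOdd zero = false
isOdd (suc n) = not (isOdd n)

step : ℕ → Complex → Complex → Complex
step m Δ B = ((Δ ∖ B) ∖ negC B) ++ (∂ B *v (+ suc m)) ++ (∂ (negC B) *v (- (+ suc m)))

mutual
  -- Sph d n = Δ^d_n   (meaningful for d ≥ 1, n ≥ d+1)
  Sph : ℕ → ℕ → Complex
  Sph zero n = []
  Sph (suc zero) n = cycle n
  Sph (suc (suc e)) zero = crossBd (suc (suc (suc e)))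
  Sph (suc (suc e)) (suc m) =
    if suc (suc (suc e)) ≤ᵇ m
    then step m (Sph (suc (suc e)) m) (Ball (suc (suc e)) (⌈ suc (suc e) /2⌉ ∸ 1) m)
    else crossBd (suc (suc (suc e)))

  -- Ball d i n = B^{d,i}_n for i ≤ ⌊d/2⌋ (d ≥ 1, n ≥ d+1)
  Ball : ℕ → ℕ → ℕ → Complex
  Ball zero i n = []
  Ball (suc zero) zero n = (- (+ 1) ∷ + n ∷ []) ∷ []
  Ball (suc zero) (suc i) n = []
  Ball (suc (suc e)) i zero = []
  Ball (suc (suc e)) i (suc m) =
    (BallAny (suc e) i m *v (+ suc m)) ++ (negC (BallPred (suc e) i m) *v (- (+ suc m)))

  -- BallAny d i n = B^{d,i}_n for i ≤ ⌊d/2⌋, and also i = k when d = 2k-1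
  BallAny : ℕ → ℕ → ℕ → Complex
  BallAny d i n =
    if isOdd d ∧ (i ≡ᵇ ⌈ d /2⌉)
    then Sph d n ∖ BallPred d i n
    else Ball d i n

  BallPred : ℕ → ℕ → ℕ → Complex
  BallPred d zero n = []
  BallPred d (suc i) n = BallAny d i n

V : ℕ → Set
V n = Fin n × Bool

toℤ : {n : ℕ} → V n → ℤ
toℤ (j , true) = + suc (toℕ j)
toℤ (j , false) = - (+ suc (toℕ j))

negV : {n : ℕ} → V n → V n
negV (j , b) = (j , not b)

IsAutomorphism : (n : ℕ) → Complex → (V n → V n) → Set
IsAutomorphism n Δ φ =
  Bijective _≡_ _≡_ φ ×
  ((σ : List (V n)) → (map toℤ σ ∈C Δ) ⇔ (map (toℤ ∘ φ) σ ∈C Δ))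

-- A facet of Δ^{2k-1}_n that is new at level m consists of ±m and a subset of a facet of ±B^{2k-1,k-1}_{m-1}.
-- Unfolding the recursion for balls, the latter consists of vertices with absolute value close to m together
-- with a facet of a sphere of dimension less than 2k-1 (or a single vertex ±1).  Hence, by induction on k:
-- vertices whose absolute values are pairwise far apart span a face only if there are at most k of them;
-- and if x, y with |x| ≤ |y| form a face with k-1 such vertices of larger absolute value, then y = x ± 1,
-- one step away from 0.  If instead the k-1 vertices lie far below x = a and |y| ≥ a + 2, then y = a + 2.
-- Conversely {j, j+1} ∪ {m_i - 2, m_i : i < k} with large gaps between the pairs is a facet, and so is the same
-- set with the last pair replaced by {n-1, n}: the ridge from which it is built lies in exactly one facet of the ball.
--
-- Given an automorphism φ, choose the k-1 auxiliary vertices one at a time so that both they and their images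
-- are far apart.  Every vertex other than ±1 has two partners in such faces while ±1 has only one, so φ maps
-- {1, -1} to itself.  Up to sign φ fixes 1, hence it fixes 2, 3, … as long as there is room for auxiliary
-- vertices above, and from there on it fixes a + 2 because it fixes a and auxiliary vertices far below a.

module Submission where

open import Defs
open import Data.Bool using (Bool; true; false; not; _∧_; T)
open import Data.Bool.Properties using (T?; T-∧)
open import Data.Empty using (⊥; ⊥-elim)
open import Data.Fin using (toℕ; fromℕ<)
import Data.Fin.Properties as Fin
open import Data.Integer using (ℤ; +_; -_; -[1+_]; ∣_∣)
import Data.Integer.Properties as ℤ
open import Data.List using (List; []; _∷_; _++_; map; filterᵇ; concatMap; length; applyUpTo)
import Data.List.Properties as List
open import Data.List.Membership.Propositional using (_∈_; _∉_; find; lose)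
open import Data.List.Membership.Propositional.Properties
open import Data.List.Relation.Binary.Subset.Propositional using (_⊆_)
open import Data.List.Relation.Unary.All as All using (All; []; _∷_)
import Data.List.Relation.Unary.All.Properties as All
open import Data.List.Relation.Unary.Any as Any using (Any; here; there)
import Data.List.Relation.Unary.Any.Properties as Any
open import Data.List.Relation.Unary.AllPairs as AllPairs using (AllPairs; []; _∷_)
import Data.List.Relation.Unary.AllPairs.Properties as AllPairs
open import Data.Nat using (ℕ; zero; suc; _+_; _*_; _∸_; _≤_; _<_; z≤n; s≤s; _≤?_; _<?_; _≤ᵇ_; _≡ᵇ_; ⌈_/2⌉; ⌊_/2⌋)
import Data.Nat.Properties as ℕ
open import Data.Product using (_×_; _,_; proj₁; proj₂; ∃-syntax)
open import Data.Sum using (_⊎_; inj₁; inj₂; [_,_]′; swap)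
open import Data.Unit using (tt)
open import Function using (id; _∘_; case_of_)
open import Function.Bundles using (mk⇔; Equivalence)
open import Relation.Binary.PropositionalEquality using (_≡_; _≢_; refl; sym; trans; cong; cong₂; subst; subst₂; module ≡-Reasoning)
open import Relation.Nullary using (¬_; yes; no)

-- Faces as lists up to equality of vertex sets

infix 4 _≋_ _∈F_

_≋_ : Face → Face → Set
F ≋ G = F ⊆ G × G ⊆ F

≋-sym : ∀ {F G} → F ≋ G → G ≋ F
≋-sym (p , q) = q , p

≋-trans : ∀ {F G H} → F ≋ G → G ≋ H → F ≋ H
≋-trans (p , q) (r , s) = r ∘ p , q ∘ s

-- A generating list stores a facet in one particular order of its vertices, so membership is taken
-- up to `≋`.
_∈F_ : Face → Complex → Set
F ∈F Δ = ∃[ G ] (G ∈ Δ × F ≋ G)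

∷-⊆ : ∀ {x : ℤ} {xs ys} → x ∈ ys → xs ⊆ ys → x ∷ xs ⊆ ys
∷-⊆ p q (here refl) = p
∷-⊆ p q (there i) = q i

∷-mono : ∀ {x : ℤ} {xs ys} → xs ⊆ ys → x ∷ xs ⊆ x ∷ ys
∷-mono q = ∷-⊆ (here refl) (there ∘ q)

∷-≋ : ∀ {x : ℤ} {xs ys} → xs ≋ ys → x ∷ xs ≋ x ∷ ys
∷-≋ (p , q) = ∷-mono p , ∷-mono q

-- Boolean reflection

T-ext : ∀ {a b} → (T a → T b) → (T b → T a) → a ≡ b
T-ext {false} {false} f g = refl
T-ext {false} {true} f g = ⊥-elim (g tt)
T-ext {true} {false} f g = ⊥-elim (f tt)
T-ext {true} {true} f g = refl

¬T⇒T-not : ∀ {b} → ¬ T b → T (not b)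
¬T⇒T-not {false} _ = tt
¬T⇒T-not {true} f = ⊥-elim (f tt)

T-not⇒¬T : ∀ {b} → T (not b) → ¬ T b
T-not⇒¬T {false} _ ()

==ℤ-sound : ∀ {x y} → T (x ==ℤ y) → x ≡ y
==ℤ-sound {x} {y} t with x ℤ.≟ y
... | yes e = e

==ℤ-complete : ∀ {x y} → x ≡ y → T (x ==ℤ y)
==ℤ-complete {x} {y} e with x ℤ.≟ y
... | yes _ = tt
... | no n = n e

⊆ᵇ⇒⊆ : ∀ σ F → T (σ ⊆ᵇ F) → σ ⊆ F
⊆ᵇ⇒⊆ σ F t v∈σ =
  Any.map ==ℤ-sound (Any.any⁻ _ F (All.lookup (All.all⁺ _ σ t) v∈σ))

⊆⇒⊆ᵇ : ∀ {σ F} → σ ⊆ F → T (σ ⊆ᵇ F)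
⊆⇒⊆ᵇ s = All.all⁻ _ (All.tabulate λ v∈σ → Any.any⁺ _ (Any.map ==ℤ-complete (s v∈σ)))

≈ᵇ⇒≋ : ∀ F G → T (F ≈ᵇ G) → F ≋ G
≈ᵇ⇒≋ F G t = let a , b = Equivalence.to T-∧ t in ⊆ᵇ⇒⊆ F G a , ⊆ᵇ⇒⊆ G F b

≋⇒≈ᵇ : ∀ {F G} → F ≋ G → T (F ≈ᵇ G)
≋⇒≈ᵇ (p , q) = Equivalence.from T-∧ (⊆⇒⊆ᵇ p , ⊆⇒⊆ᵇ q)

∈-filterᵇ⁺ : ∀ {A : Set} (p : A → Bool) {x xs} → x ∈ xs → T (p x) → x ∈ filterᵇ p xs
∈-filterᵇ⁺ p = ∈-filter⁺ (T? ∘ p)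

∈-filterᵇ⁻ : ∀ {A : Set} (p : A → Bool) {x} xs → x ∈ filterᵇ p xs → x ∈ xs × T (p x)
∈-filterᵇ⁻ p xs = ∈-filter⁻ (T? ∘ p) {xs = xs}

∈-∖⁺ : ∀ {F Δ} Γ → F ∈ Δ → (∀ {H} → H ∈ Γ → ¬ F ⊆ H) → F ∈ Δ ∖ Γ
∈-∖⁺ {F} Γ F∈Δ f = ∈-filterᵇ⁺ _ F∈Δ (¬T⇒T-not λ t →
  let H , H∈Γ , t′ = find (Any.any⁻ (F ⊆ᵇ_) Γ t) in f H∈Γ (⊆ᵇ⇒⊆ F H t′))

∈-∖⁻ : ∀ {F} Δ Γ → F ∈ Δ ∖ Γ → F ∈ Δ × (∀ {H} → H ∈ Γ → ¬ F ⊆ H)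
∈-∖⁻ {F} Δ Γ i = let a , b = ∈-filterᵇ⁻ _ Δ i in
  a , λ H∈Γ s → T-not⇒¬T b (Any.any⁺ (F ⊆ᵇ_) (Any.map (λ { refl → ⊆⇒⊆ᵇ s }) H∈Γ))

-- Pigeonhole for duplicate-free lists

Distinct : List ℤ → Set
Distinct = AllPairs _≢_

distinct-⊆-length : ∀ {xs ys} → Distinct xs → xs ⊆ ys → length xs ≤ length ys
distinct-⊆-length [] s = z≤n
distinct-⊆-length {x ∷ xs} {ys} (x∉ ∷ d) s with ∈-∃++ (s (here refl))
... | as , bs , refl = subst (suc (length xs) ≤_)
        (sym (trans (List.length-++ as) (trans (ℕ.+-suc (length as) (length bs)) (cong suc (sym
            (List.length-++ as))))))
        (s≤s (distinct-⊆-length d s′))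
  where
  s′ : xs ⊆ as ++ bs
  s′ {v} i with ∈-++⁻ as (s (there i))
  ... | inj₁ j = ∈-++⁺ˡ j
  ... | inj₂ (here refl) = ⊥-elim (All.lookup x∉ i refl)
  ... | inj₂ (there j) = ∈-++⁺ʳ as j

-- An element of `ys` outside `xs` would extend `xs` to a longer distinct list inside `ys`.
distinct-⊆-≋ : ∀ {xs ys} → Distinct xs → xs ⊆ ys → length ys ≤ length xs → ys ≋ xs
distinct-⊆-≋ {xs} {ys} d s l = (λ {v} i → case (Any.any? (ℤ._≟_ v) xs) of λ
  { (yes p) → p
  ; (no q) → ⊥-elim (ℕ.<-irrefl refl (ℕ.≤-trans
      (distinct-⊆-length (All.tabulate (λ { j refl → q j }) ∷ d) (∷-⊆ i s)) l)) }) , s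

-- Boundaries

dedup-⊆ : ∀ {F} Δ → F ∈ dedup Δ → F ∈ Δ
dedup-⊆ (G ∷ Δ) (here refl) = here refl
dedup-⊆ (G ∷ Δ) (there i) = there (dedup-⊆ Δ (proj₁ (∈-filterᵇ⁻ _ (dedup Δ) i)))

∈F-dedup : ∀ {F} Δ → F ∈ Δ → F ∈F dedup Δ
∈F-dedup {F} (G ∷ Δ) (here refl) = F , here refl , id , id
∈F-dedup {F} (G ∷ Δ) (there i) with ∈F-dedup Δ i
... | H , H∈ , e with T? (G ≈ᵇ H)
... | yes t = G , here refl , ≋-trans e (≋-sym (≈ᵇ⇒≋ G H t))
... | no t = H , there (∈-filterᵇ⁺ _ H∈ (¬T⇒T-not t)) , e

dedup-inequiv : ∀ Δ → AllPairs (λ F G → ¬ F ≋ G) (dedup Δ)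
dedup-inequiv [] = []
dedup-inequiv (F ∷ Δ) =
  All.tabulate (λ i e → T-not⇒¬T (proj₂ (∈-filterᵇ⁻ _ (dedup Δ) i)) (≋⇒≈ᵇ e))
  ∷ AllPairs.filter⁺ _ (dedup-inequiv Δ)

count-none : ∀ p Δ → (∀ {H} → H ∈ Δ → ¬ T (p H)) → count p Δ ≡ 0
count-none p [] f = refl
count-none p (F ∷ Δ) f with p F in eq
... | true = ⊥-elim (f (here refl) (subst T (sym eq) tt))
... | false = count-none p Δ (f ∘ there)

count-unique : ∀ p {Δ G} → AllPairs (λ F H → ¬ F ≋ H) Δ → G ∈ Δ → T (p G) →
  (∀ {H} → H ∈ Δ → T (p H) → H ≋ G) → count p Δ ≡ 1
count-unique p {F ∷ Δ} (d ∷ ds) (here refl) t f with p F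
... | true = cong suc (count-none p Δ λ i t′ → All.lookup d i (≋-sym (f (there i) t′)))
count-unique p {F ∷ Δ} (d ∷ ds) (there i) t f with p F in eq
... | true = ⊥-elim (All.lookup d i (f (here refl) (subst T (sym eq) tt)))
... | false = count-unique p ds i t (f ∘ there)

removeEach-sound : ∀ {τ} F → τ ∈ removeEach F → τ ⊆ F × suc (length τ) ≡ length F
removeEach-sound (x ∷ F) (here refl) = there , refl
removeEach-sound (x ∷ F) (there i) with ∈-map⁻ (x ∷_) i
... | τ , j , refl = let a , b = removeEach-sound F j in ∷-mono a , cong suc b

removeEach-complete : ∀ {v} F → v ∈ F → ∃[ τ ] (τ ∈ removeEach F × F ⊆ v ∷ τ)
removeEach-complete (x ∷ F) (here refl) = F , here refl , id
removeEach-complete {v} (x ∷ F) (there i) with removeEach-complete F i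
... | τ , j , s = x ∷ τ , there (∈-map⁺ (x ∷_) j) , λ
  { (here refl) → there (here refl)
  ; (there k) → case s k of λ { (here e) → here e ; (there l) → there (there l) } }

∂-sound : ∀ {τ} B → τ ∈ ∂ B → ∃[ β ] (β ∈ B × τ ⊆ β × suc (length τ) ≡ length β)
∂-sound B i with ∈-concatMap⁻ removeEach {xs = dedup B} (proj₁ (∈-filterᵇ⁻ _ (concatMap removeEach (dedup B)) i))
... | j with find j
... | β , β∈ , k = β , dedup-⊆ B β∈ , removeEach-sound β k

-- Removing `v` from the copy `γ` of `β` kept by `dedup` gives a ridge `ρ`, which by its length has
-- the same vertices as `τ`. Uniqueness of `β` up to order makes the count equal to 1.
∂-complete : ∀ {v τ β} B → β ∈ B → β ≋ v ∷ τ → Distinct (v ∷ τ) →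
  (∀ {H} → H ∈ B → length H ≡ suc (length τ)) → (∀ {H} → H ∈ B → τ ⊆ H → H ≋ β) → τ ∈F ∂ B
∂-complete {v} {τ} {β} B β∈ e (v∉ ∷ d) len uniq with ∈F-dedup B β∈
... | γ , γ∈ , e′ with removeEach-complete γ (proj₁ e′ (proj₂ e (here refl)))
... | ρ , ρ∈ , s = ρ , ∈-filterᵇ⁺ _ (∈-concatMap⁺ removeEach (Any.map (λ { refl → ρ∈ }) γ∈)) one , ≋-sym ρ≋τ
  where
  τ⊆ρ : τ ⊆ ρ
  τ⊆ρ i with s (proj₁ e′ (proj₂ e (there i)))
  ... | here refl = ⊥-elim (All.lookup v∉ i refl)
  ... | there j = j
  ρ≋τ : ρ ≋ τ
  ρ≋τ = distinct-⊆-≋ d τ⊆ρ (ℕ.≤-reflexive (ℕ.suc-injective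
          (trans (proj₂ (removeEach-sound γ ρ∈)) (len (dedup-⊆ B γ∈)))))
  one : T (count (ρ ⊆ᵇ_) (dedup B) ≡ᵇ 1)
  one = ℕ.≡⇒≡ᵇ _ 1 (count-unique (ρ ⊆ᵇ_) (dedup-inequiv B) γ∈ (⊆⇒⊆ᵇ (proj₁ (removeEach-sound γ ρ∈)))
    λ {H} H∈ t → ≋-trans (uniq (dedup-⊆ B H∈) (⊆ᵇ⇒⊆ ρ H t ∘ proj₂ ρ≋τ)) e′)

-- Central symmetry

negF : Face → Face
negF = map -_

∈-negF : ∀ {v F} → v ∈ F → - v ∈ negF F
∈-negF = ∈-map⁺ -_

∈-negF⁻ : ∀ {v F} → v ∈ negF F → - v ∈ F
∈-negF⁻ {v} {F} i with ∈-map⁻ -_ i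
... | w , j , refl = subst (_∈ F) (sym (ℤ.neg-involutive w)) j

negF-involutive : ∀ F → negF (negF F) ≡ F
negF-involutive [] = refl
negF-involutive (x ∷ F) = cong₂ _∷_ (ℤ.neg-involutive x) (negF-involutive F)

negF-⊆ : ∀ {F G} → F ⊆ G → negF F ⊆ negF G
negF-⊆ {F} {G} s {v} i = subst (_∈ negF G) (ℤ.neg-involutive v) (∈-negF (s (∈-negF⁻ i)))

negF-⊆⁻ : ∀ {F G} → negF F ⊆ negF G → F ⊆ G
negF-⊆⁻ {F} {G} s {v} i = subst (_∈ G) (ℤ.neg-involutive v) (∈-negF⁻ (s (∈-negF i)))

negF-⊆ᵇ : ∀ F G → (negF F ⊆ᵇ negF G) ≡ (F ⊆ᵇ G)
negF-⊆ᵇ F G = T-ext (λ t → ⊆⇒⊆ᵇ (negF-⊆⁻ (⊆ᵇ⇒⊆ (negF F) (negF G) t))) (λ t → ⊆⇒⊆ᵇ (negF-⊆ (⊆ᵇ⇒⊆ F G t)))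

negF-≈ᵇ : ∀ F G → (negF F ≈ᵇ negF G) ≡ (F ≈ᵇ G)
negF-≈ᵇ F G = cong₂ _∧_ (negF-⊆ᵇ F G) (negF-⊆ᵇ G F)

filterᵇ-map : ∀ {A B : Set} (f : A → B) {p : B → Bool} {q} → (∀ x → p (f x) ≡ q x) →
  ∀ xs → filterᵇ p (map f xs) ≡ map f (filterᵇ q xs)
filterᵇ-map f {p} {q} e [] = refl
filterᵇ-map f {p} {q} e (x ∷ xs) rewrite e x with q x
... | true = cong (f x ∷_) (filterᵇ-map f e xs)
... | false = filterᵇ-map f e xs

dedup-negC : ∀ Δ → dedup (negC Δ) ≡ negC (dedup Δ)
dedup-negC [] = refl
dedup-negC (F ∷ Δ) = cong (negF F ∷_) (trans (cong (filterᵇ _) (dedup-negC Δ))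
  (filterᵇ-map negF (λ G → cong not (negF-≈ᵇ F G)) (dedup Δ)))

count-negC : ∀ τ Δ → count (negF τ ⊆ᵇ_) (negC Δ) ≡ count (τ ⊆ᵇ_) Δ
count-negC τ [] = refl
count-negC τ (F ∷ Δ) rewrite negF-⊆ᵇ τ F with τ ⊆ᵇ F
... | true = cong suc (count-negC τ Δ)
... | false = count-negC τ Δ

removeEach-map : ∀ (f : ℤ → ℤ) F → removeEach (map f F) ≡ map (map f) (removeEach F)
removeEach-map f [] = refl
removeEach-map f (x ∷ F) = cong (map f F ∷_) (trans (cong (map (f x ∷_)) (removeEach-map f F))
  (trans (sym (List.map-∘ (removeEach F))) (List.map-∘ (removeEach F))))

ridges-negC : ∀ Δ → concatMap removeEach (negC Δ) ≡ negC (concatMap removeEach Δ)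
ridges-negC [] = refl
ridges-negC (F ∷ Δ) = trans (cong₂ _++_ (removeEach-map -_ F) (ridges-negC Δ))
  (sym (List.map-++ negF (removeEach F) (concatMap removeEach Δ)))

-- Each operation in `∂` commutes with negation already on lists. Facets at the new negative vertex
-- can therefore be read off from `∂ B`.
∂-negC : ∀ B → ∂ (negC B) ≡ negC (∂ B)
∂-negC B rewrite dedup-negC B | ridges-negC (dedup B) =
  filterᵇ-map negF (λ τ → cong (_≡ᵇ 1) (count-negC τ (dedup B))) (concatMap removeEach (dedup B))

∈-negC⁻ : ∀ {F} Δ → F ∈ negC Δ → negF F ∈ Δ
∈-negC⁻ Δ i with ∈-map⁻ negF i
... | G , j , refl = subst (_∈ Δ) (sym (negF-involutive G)) j

∈-negC⁺ : ∀ {F} Δ → negF F ∈ Δ → F ∈ negC Δ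
∈-negC⁺ {F} Δ i = subst (_∈ negC Δ) (negF-involutive F) (∈-map⁺ negF i)

-- Facets of cycles, cross-polytopes and spheres by cases

data CycleEdge (m : ℕ) : Face → Set where
  up : ∀ {i} → i < m → CycleEdge m (+ suc i ∷ + suc (suc i) ∷ [])
  down : ∀ {i} → i < m → CycleEdge m (-[1+ i ] ∷ -[1+ suc i ] ∷ [])
  wrap⁺ : CycleEdge m (+ suc m ∷ -[1+ 0 ] ∷ [])
  wrap⁻ : CycleEdge m (-[1+ m ] ∷ + 1 ∷ [])

path-applyUpTo⁻ : ∀ (f : ℕ → ℤ) n {F} y ys → F ∈ path (applyUpTo f (suc n) ++ y ∷ ys) →
  (∃[ i ] (i < n × F ≡ f i ∷ f (suc i) ∷ [])) ⊎ (F ≡ f n ∷ y ∷ []) ⊎ F ∈ path (y ∷ ys)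
path-applyUpTo⁻ f zero y ys (here e) = inj₂ (inj₁ e)
path-applyUpTo⁻ f zero y ys (there i) = inj₂ (inj₂ i)
path-applyUpTo⁻ f (suc n) y ys (here e) = inj₁ (0 , s≤s z≤n , e)
path-applyUpTo⁻ f (suc n) y ys (there i) with path-applyUpTo⁻ (f ∘ suc) n y ys i
... | inj₁ (j , l , e) = inj₁ (suc j , s≤s l , e)
... | inj₂ r = inj₂ r

path-applyUpTo⁺ : ∀ (f : ℕ → ℤ) n {F} y ys →
  (∃[ i ] (i < n × F ≡ f i ∷ f (suc i) ∷ [])) ⊎ (F ≡ f n ∷ y ∷ []) ⊎ F ∈ path (y ∷ ys) →
  F ∈ path (applyUpTo f (suc n) ++ y ∷ ys)
path-applyUpTo⁺ f zero y ys (inj₂ (inj₁ e)) = here e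
path-applyUpTo⁺ f zero y ys (inj₂ (inj₂ i)) = there i
path-applyUpTo⁺ f (suc n) y ys (inj₁ (zero , l , e)) = here e
path-applyUpTo⁺ f (suc n) y ys (inj₁ (suc j , s≤s l , e)) =
  there (path-applyUpTo⁺ (f ∘ suc) n y ys (inj₁ (j , l , e)))
path-applyUpTo⁺ f (suc n) y ys (inj₂ r) = there (path-applyUpTo⁺ (f ∘ suc) n y ys (inj₂ r))

cycle-path : ∀ m → cycle (suc m) ≡
  path (applyUpTo (λ j → + suc j) (suc m) ++ (applyUpTo -[1+_] (suc m) ++ + 1 ∷ []))
cycle-path m = cong path (trans (List.++-assoc pos (map -_ pos) (+ 1 ∷ []))
  (cong (λ l → pos ++ (l ++ + 1 ∷ [])) (List.map-applyUpTo (λ j → + suc j) -_ (suc m))))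
  where pos = applyUpTo (λ j → + suc j) (suc m)

cycle-sound : ∀ m {F} → F ∈ cycle (suc m) → CycleEdge m F
cycle-sound m {F} i
  with path-applyUpTo⁻ (λ j → + suc j) m _ _ (subst (F ∈_) (cycle-path m) i)
... | inj₁ (j , l , refl) = up l
... | inj₂ (inj₁ refl) = wrap⁺
... | inj₂ (inj₂ i′) with path-applyUpTo⁻ -[1+_] m _ _ i′
... | inj₁ (j , l , refl) = down l
... | inj₂ (inj₁ refl) = wrap⁻

cycle-complete : ∀ m {F} → CycleEdge m F → F ∈ cycle (suc m)
cycle-complete m {F} e = subst (F ∈_) (sym (cycle-path m)) (path-applyUpTo⁺ (λ j → + suc j) m _ _ (go e))
  where
  go : CycleEdge m F → _
  go (up l) = inj₁ (_ , l , refl)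
  go wrap⁺ = inj₂ (inj₁ refl)
  go (down l) = inj₂ (inj₂ (path-applyUpTo⁺ -[1+_] m (+ 1) [] (inj₁ (_ , l , refl))))
  go wrap⁻ = inj₂ (inj₂ (path-applyUpTo⁺ -[1+_] m (+ 1) [] (inj₂ (inj₁ refl))))

data CrossFace (m : ℕ) (Δ : Complex) : Face → Set where
  pos : ∀ {F} → F ∈ Δ → CrossFace m Δ (+ suc m ∷ F)
  neg : ∀ {F} → F ∈ Δ → CrossFace m Δ (-[1+ m ] ∷ F)

crossBd-sound : ∀ m {F} → F ∈ crossBd (suc m) → CrossFace m (crossBd m) F
crossBd-sound m i with find (∈-concatMap⁻ (λ F → (+ suc m ∷ F) ∷ (- (+ suc m) ∷ F) ∷ []) {xs = crossBd m} i)
... | G , j , here refl = pos j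
... | G , j , there (here refl) = neg j

crossBd-complete : ∀ m {F} → CrossFace m (crossBd m) F → F ∈ crossBd (suc m)
crossBd-complete m (pos i) = ∈-concatMap⁺ _ (lose i (here refl))
crossBd-complete m (neg i) = ∈-concatMap⁺ _ (lose i (there (here refl)))

crossBd-neg : ∀ m {F} → F ∈ crossBd m → negF F ∈ crossBd m
crossBd-neg zero (here refl) = here refl
crossBd-neg (suc m) i with crossBd-sound m i
... | pos j = crossBd-complete m (neg (crossBd-neg m j))
... | neg j = crossBd-complete m (pos (crossBd-neg m j))

-- Conditions on `negC B` are turned into conditions on `B` for the negated face, so that only `B`
-- has to be analysed.
data StepFace (m : ℕ) (Δ B : Complex) : Face → Set where
  old : ∀ {F} → F ∈ Δ → (∀ {H} → H ∈ B → ¬ F ⊆ H) → (∀ {H} → H ∈ B → ¬ negF F ⊆ H) → StepFace m Δ B F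
  top⁺ : ∀ {τ} → τ ∈ ∂ B → StepFace m Δ B (+ suc m ∷ τ)
  top⁻ : ∀ {τ} → negF τ ∈ ∂ B → StepFace m Δ B (-[1+ m ] ∷ τ)

step-sound : ∀ m Δ B {F} → F ∈ step m Δ B → StepFace m Δ B F
step-sound m Δ B i with ∈-++⁻ ((Δ ∖ B) ∖ negC B) i
... | inj₁ j = let a , b = ∈-∖⁻ (Δ ∖ B) (negC B) j
                   c , d = ∈-∖⁻ Δ B a
               in old c d λ {H} h s → b (∈-map⁺ negF h) (subst (_⊆ negF H) (negF-involutive _) (negF-⊆ s))
... | inj₂ j with ∈-++⁻ (∂ B *v (+ suc m)) j
... | inj₁ k with ∈-map⁻ (+ suc m ∷_) k
... | τ , l , refl = top⁺ l
step-sound m Δ B i | inj₂ j | inj₂ k with ∈-map⁻ (- (+ suc m) ∷_) k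
... | τ , l , refl = top⁻ (∈-negC⁻ (∂ B) (subst (τ ∈_) (∂-negC B) l))

step-complete : ∀ m Δ B {F} → StepFace m Δ B F → F ∈ step m Δ B
step-complete m Δ B {F} (old i f g) = ∈-++⁺ˡ (∈-∖⁺ (negC B) (∈-∖⁺ B i f)
  λ h s → g (∈-negC⁻ B h) (negF-⊆ s))
step-complete m Δ B (top⁺ i) = ∈-++⁺ʳ ((Δ ∖ B) ∖ negC B) (∈-++⁺ˡ (∈-map⁺ _ i))
step-complete m Δ B {F} (top⁻ i) = ∈-++⁺ʳ ((Δ ∖ B) ∖ negC B) (∈-++⁺ʳ (∂ B *v (+ suc m))
  (∈-map⁺ _ (subst (_ ∈_) (sym (∂-negC B)) (∈-negC⁺ (∂ B) i))))

step-neg : ∀ m Δ B → (∀ {F} → F ∈ Δ → negF F ∈F Δ) → ∀ {F} → F ∈ step m Δ B → negF F ∈F step m Δ B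
step-neg m Δ B h {F} i with step-sound m Δ B i
... | old {F} a b c with h a
... | G , g , e = G , step-complete m Δ B (old g (λ k s → c k (s ∘ proj₁ e))
        λ k s → b k (negF-⊆⁻ (λ v → negF-⊆ s (subst (_ ∈_) (sym (negF-involutive G)) (proj₁ e v))))) , e
step-neg m Δ B h {F} i | top⁺ {τ} a = _ , step-complete m Δ B (top⁻ (subst (_∈ ∂ B) (sym
    (negF-involutive τ)) a)) , id , id
step-neg m Δ B h {F} i | top⁻ a = _ , step-complete m Δ B (top⁺ a) , id , id

Sph-step : ∀ e m → 3 + e ≤ m → Sph (2 + e) (suc m) ≡ step m (Sph (2 + e) m) (Ball (2 + e) (⌈ 2 + e /2⌉ ∸ 1) m)
Sph-step e m l with 3 + e ≤ᵇ m in eq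
... | true = refl
... | false = ⊥-elim (subst T eq (ℕ.≤⇒≤ᵇ l))

Sph-cross : ∀ e m → m < 3 + e → Sph (2 + e) (suc m) ≡ crossBd (3 + e)
Sph-cross e m l with 3 + e ≤ᵇ m in eq
... | false = refl
... | true = ⊥-elim (ℕ.<⇒≱ l (ℕ.≤ᵇ⇒≤ _ _ (subst T (sym eq) tt)))

-- With d = 2 + e and n = m + 1, the condition `m < 3 + e` says n ≤ d + 1; there `Sph` is the
-- boundary of the cross-polytope.
data SphFace (e : ℕ) (m : ℕ) (F : Face) : Set where
  cross : m < 3 + e → F ∈ crossBd (3 + e) → SphFace e m F
  stepped : 3 + e ≤ m → StepFace m (Sph (2 + e) m) (Ball (2 + e) (⌈ 2 + e /2⌉ ∸ 1) m) F → SphFace e m F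

Sph-sound : ∀ e m {F} → F ∈ Sph (2 + e) (suc m) → SphFace e m F
Sph-sound e m {F} i with 3 + e ≤? m
... | yes l = stepped l (step-sound m _ _ (subst (F ∈_) (Sph-step e m l) i))
... | no l = cross (ℕ.≰⇒> l) (subst (F ∈_) (Sph-cross e m (ℕ.≰⇒> l)) i)

Sph-complete : ∀ e m {F} → SphFace e m F → F ∈ Sph (2 + e) (suc m)
Sph-complete e m {F} (cross l i) = subst (F ∈_) (sym (Sph-cross e m l)) i
Sph-complete e m {F} (stepped l i) = subst (F ∈_) (sym (Sph-step e m l)) (step-complete m _ _ i)

Sph-neg : ∀ d n {F} → 1 ≤ n → F ∈ Sph d n → negF F ∈F Sph d n
Sph-neg zero n l ()
Sph-neg (suc zero) (suc m) l i = _ , cycle-complete m (go (cycle-sound m i)) , id , id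
  where
  go : ∀ {F} → CycleEdge m F → CycleEdge m (negF F)
  go (up l) = down l
  go (down l) = up l
  go wrap⁺ = wrap⁻
  go wrap⁻ = wrap⁺
Sph-neg (suc (suc e)) (suc m) l i with Sph-sound e m i
... | cross l j = _ , Sph-complete e m (cross l (crossBd-neg (3 + e) j)) , id , id
... | stepped l j = subst (negF _ ∈F_) (sym (Sph-step e m l))
  (step-neg m (Sph (2 + e) m) (Ball (2 + e) (⌈ 2 + e /2⌉ ∸ 1) m) (Sph-neg (2 + e) m (ℕ.≤-trans (s≤s z≤n) l))
    (step-complete m _ _ j))

-- Sizes and vertex ranges

-- Doubling by recursion: the odd dimension 2p + 1 is `suc (ev p)`, and `suc (ev (suc p))` reduces
-- to `3 + ev p`.
ev : ℕ → ℕ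
ev zero = 0
ev (suc p) = suc (suc (ev p))

isOdd-ev : ∀ p → isOdd (ev p) ≡ false
isOdd-ev zero = refl
isOdd-ev (suc p) rewrite isOdd-ev p = refl

⌊ev/2⌋ : ∀ p → ⌊ ev p /2⌋ ≡ p
⌊ev/2⌋ zero = refl
⌊ev/2⌋ (suc p) = cong suc (⌊ev/2⌋ p)

odd-ev : ∀ d → T (isOdd d) → ∃[ p ] d ≡ suc (ev p)
odd-ev (suc zero) t = 0 , refl
odd-ev (suc (suc d)) t with odd-ev d (subst T (¬¬ (isOdd d)) t)
  where
  ¬¬ : ∀ b → not (not b) ≡ b
  ¬¬ true = refl
  ¬¬ false = refl
... | p , refl = suc p , refl

data BallFace (e i m : ℕ) : Face → Set where
  plus : ∀ {F} → F ∈ BallAny (suc e) i m → BallFace e i m (+ suc m ∷ F)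
  minus : ∀ {j F} → i ≡ suc j → F ∈ BallAny (suc e) j m → BallFace e i m (-[1+ m ] ∷ negF F)

Ball-sound : ∀ e i m {F} → F ∈ Ball (2 + e) i (suc m) → BallFace e i m F
Ball-sound e i m k with ∈-++⁻ (BallAny (suc e) i m *v (+ suc m)) k
... | inj₁ l with ∈-map⁻ (+ suc m ∷_) l
... | G , g , refl = plus g
Ball-sound e (suc i) m k | inj₂ l with ∈-map⁻ (- (+ suc m) ∷_) l
... | G , g , refl with ∈-map⁻ negF g
... | H , h , refl = minus refl h

-- For a ball defined as a complement, `whole` keeps only membership in the sphere and forgets the
-- removed ball; this suffices for upper bounds.
data BallAnyFace (d i m : ℕ) (F : Face) : Set where
  whole : ∀ p → d ≡ suc (ev p) → i ≡ suc p → F ∈ Sph d m → BallAnyFace d i m F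
  ball : F ∈ Ball d i m → BallAnyFace d i m F

BallAny-sound : ∀ d i m {F} → F ∈ BallAny d i m → BallAnyFace d i m F
BallAny-sound d i m {F} k with isOdd d ∧ (i ≡ᵇ ⌈ d /2⌉) in eq
... | false = ball k
... | true with Equivalence.to (T-∧ {isOdd d}) (subst T (sym eq) tt)
... | a , b with odd-ev d a
... | p , refl = whole p refl (trans (ℕ.≡ᵇ⇒≡ i _ b) (cong suc (⌊ev/2⌋ p))) (proj₁ (∈-∖⁻ (Sph (suc (ev p)) m)
    (BallPred (suc (ev p)) i m) k))

-- The range of the vertices is claimed only for `d < n`: below that, `Sph` in dimension at least 2
-- is still the cross-polytope boundary on d + 1 pairs.
SizeIn : ℕ → ℕ → Face → Set
SizeIn d n F = length F ≡ suc d × (d < n → All (λ v → ∣ v ∣ ≤ n) F)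

crossBd-size : ∀ m {F} → F ∈ crossBd m → length F ≡ m × All (λ v → ∣ v ∣ ≤ m) F
crossBd-size zero (here refl) = refl , []
crossBd-size (suc m) i with crossBd-sound m i
... | pos j = let a , b = crossBd-size m j in cong suc a , ℕ.≤-refl ∷ All.map ℕ.m≤n⇒m≤1+n b
... | neg j = let a , b = crossBd-size m j in cong suc a , ℕ.≤-refl ∷ All.map ℕ.m≤n⇒m≤1+n b

negF-bound : ∀ {n F} → All (λ v → ∣ v ∣ ≤ n) F → All (λ v → ∣ v ∣ ≤ n) (negF F)
negF-bound {n} b = All.map⁺ (All.map (λ {v} → subst (_≤ n) (sym (ℤ.∣-i∣≡∣i∣ v))) b)

bound-suc : ∀ {n F} → All (λ v → ∣ v ∣ ≤ n) F → All (λ v → ∣ v ∣ ≤ suc n) F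
bound-suc = All.map ℕ.m≤n⇒m≤1+n

CycleEdge-size : ∀ m {F} → CycleEdge m F → length F ≡ 2 × All (λ v → ∣ v ∣ ≤ suc m) F
CycleEdge-size m (up l) = refl , ℕ.m≤n⇒m≤1+n l ∷ s≤s l ∷ []
CycleEdge-size m (down l) = refl , ℕ.m≤n⇒m≤1+n l ∷ s≤s l ∷ []
CycleEdge-size m wrap⁺ = refl , ℕ.≤-refl ∷ s≤s z≤n ∷ []
CycleEdge-size m wrap⁻ = refl , ℕ.≤-refl ∷ s≤s z≤n ∷ []

Sph-size : ∀ d n {F} → F ∈ Sph d n → SizeIn d n F
Ball-size : ∀ d i n {F} → F ∈ Ball d i n → SizeIn d n F
BallAny-size : ∀ d i n {F} → F ∈ BallAny d i n → SizeIn d n F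

Sph-size (suc zero) (suc m) k = let a , b = CycleEdge-size m (cycle-sound m k) in a , λ _ → b
Sph-size (suc (suc e)) zero k = proj₁ (crossBd-size (3 + e) k) , λ ()
Sph-size (suc (suc e)) (suc m) k with Sph-sound e m k
... | cross l j = let a , b = crossBd-size (3 + e) j in a , λ l′ → All.map (λ q → ℕ.≤-trans q l′) b
... | stepped l (old j _ _) = let a , b = Sph-size (2 + e) m j in a , λ _ → bound-suc (b l)
... | stepped l (top⁺ j) with ∂-sound _ j
... | β , β∈ , s , q with Ball-size (2 + e) _ m β∈
... | a , b = trans q a , λ _ → ℕ.≤-refl ∷ bound-suc (All.tabulate (All.lookup (b l) ∘ s))
Sph-size (suc (suc e)) (suc m) k | stepped l (top⁻ {τ} j) with ∂-sound _ j
... | β , β∈ , s , q with Ball-size (2 + e) _ m β∈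
... | a , b = trans (cong suc (sym (List.length-map -_ τ))) (trans q a) ,
  λ _ → ℕ.≤-refl ∷ bound-suc (subst (All _) (negF-involutive τ) (negF-bound (All.tabulate (All.lookup (b l) ∘ s))))

Ball-size (suc zero) zero n (here refl) = refl , λ l → ℕ.≤-trans (s≤s z≤n) l ∷ ℕ.≤-refl ∷ []
Ball-size (suc (suc e)) i (suc m) k with Ball-sound e i m k
... | plus j = let a , b = BallAny-size (suc e) i m j in
  cong suc a , λ l → ℕ.≤-refl ∷ bound-suc (b (ℕ.≤-pred l))
... | minus {i′} {F} refl j = let a , b = BallAny-size (suc e) i′ m j in
  cong suc (trans (List.length-map -_ F) a) , λ l → ℕ.≤-refl ∷ bound-suc (negF-bound (b (ℕ.≤-pred l)))

BallAny-size d i n k with BallAny-sound d i n k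
... | whole p _ _ j = Sph-size d n j
... | ball j = Ball-size d i n j

-- Coarse shape of the facets: away from a bounded window of large absolute values, a facet of
-- a ball lies in a facet of a sphere of smaller dimension, or contains only one of 1 and -1.

data Coarse (i m s : ℕ) (F : Face) : Set where
  inSph : ∀ p m′ {Ψ} → p < i → m ≤ m′ + s → m′ ≤ m → suc (ev p) < m′ → Ψ ∈ Sph (suc (ev p)) m′ →
    (∀ {v} → v ∈ F → m′ < ∣ v ∣ ⊎ v ∈ Ψ) → Coarse i m s F
  unit : ∀ m′ u → ∣ u ∣ ≡ 1 → m ≤ m′ + s → m′ ≤ m → (∀ {v} → v ∈ F → m′ < ∣ v ∣ ⊎ v ≡ u) → Coarse i m s F

Coarse-⊆ : ∀ {i m s F G} → G ⊆ F → Coarse i m s F → Coarse i m s G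
Coarse-⊆ g (inSph p m′ a b c d e f) = inSph p m′ a b c d e (f ∘ g)
Coarse-⊆ g (unit m′ u a b c f) = unit m′ u a b c (f ∘ g)

Coarse-mono : ∀ {i j m s F} → i ≤ j → Coarse i m s F → Coarse j m s F
Coarse-mono l (inSph p m′ a b c d e f) = inSph p m′ (ℕ.≤-trans a l) b c d e f
Coarse-mono l (unit m′ u a b c f) = unit m′ u a b c f

Coarse-neg : ∀ {i m s F} → Coarse i m s F → Coarse i m s (negF F)
Coarse-neg (inSph p m′ a b c d e f) with Sph-neg (suc (ev p)) m′ (ℕ.≤-trans (s≤s z≤n) d) e
... | Ψ , k , s = inSph p m′ a b c d k λ {v} v∈ → case f (∈-negF⁻ v∈) of λ
  { (inj₁ l) → inj₁ (subst (m′ <_) (ℤ.∣-i∣≡∣i∣ v) l)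
  ; (inj₂ l) → inj₂ (proj₁ s (subst (_∈ _) (ℤ.neg-involutive v) (∈-negF l))) }
Coarse-neg (unit m′ u a b c f) = unit m′ (- u) (trans (ℤ.∣-i∣≡∣i∣ u) a) b c λ {v} v∈ → case f (∈-negF⁻ v∈) of λ
  { (inj₁ l) → inj₁ (subst (m′ <_) (ℤ.∣-i∣≡∣i∣ v) l)
  ; (inj₂ l) → inj₂ (trans (sym (ℤ.neg-involutive v)) (cong -_ l)) }

Coarse-∷ : ∀ {i m s F x} → ∣ x ∣ ≡ suc m → Coarse i m s F → Coarse i (suc m) (suc s) (x ∷ F)
Coarse-∷ {m = m} {s} q (inSph p m′ a b c d e f) =
  inSph p m′ a (subst (suc m ≤_) (sym (ℕ.+-suc m′ s)) (s≤s b)) (ℕ.m≤n⇒m≤1+n c) d e λ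
  { (here refl) → inj₁ (subst (m′ <_) (sym q) (s≤s c)) ; (there k) → f k }
Coarse-∷ {m = m} {s} q (unit m′ u a b c f) =
  unit m′ u a (subst (suc m ≤_) (sym (ℕ.+-suc m′ s)) (s≤s b)) (ℕ.m≤n⇒m≤1+n c) λ
  { (here refl) → inj₁ (subst (m′ <_) (sym q) (s≤s c)) ; (there k) → f k }

-- Each unfolding of the ball recursion sets aside one vertex of maximal absolute value and lowers d
-- and m by one, so the window has width at most d. It ends at a whole sphere of dimension 2p + 1
-- and index p + 1, where p < i because the index never grows, or at the edge of `B^{1,0}`, which
-- leaves -1 up to sign.
Ball-coarse : ∀ d i m {F} → d < m → F ∈ Ball d i m → Coarse i m d F
BallAny-coarse : ∀ d i m {F} → d < m → F ∈ BallAny d i m → Coarse i m d F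

Ball-coarse (suc zero) zero (suc m) l (here refl) = unit m -[1+ 0 ] refl (ℕ.≤-reflexive (ℕ.+-comm 1 m)) (ℕ.n≤1+n m) λ
  { (here refl) → inj₂ refl ; (there (here refl)) → inj₁ ℕ.≤-refl }
Ball-coarse (suc (suc e)) i (suc m) l k with Ball-sound e i m k
... | plus j = Coarse-∷ refl (BallAny-coarse (suc e) i m (ℕ.≤-pred l) j)
... | minus {i′} refl j = Coarse-mono (ℕ.n≤1+n i′) (Coarse-∷ refl (Coarse-neg (BallAny-coarse (suc e) i′ m
    (ℕ.≤-pred l) j)))

BallAny-coarse d i m l k with BallAny-sound d i m k
... | whole p refl refl j = inSph p m ℕ.≤-refl (ℕ.m≤m+n m d) ℕ.≤-refl l j inj₂
... | ball j = Ball-coarse d i m l j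

-- Upper bounds

Far : ℕ → ℤ → ℤ → Set
Far c a b = ∣ a ∣ + c < ∣ b ∣ ⊎ ∣ b ∣ + c < ∣ a ∣

ev-mono : ∀ {p q} → p ≤ q → ev p ≤ ev q
ev-mono z≤n = z≤n
ev-mono (s≤s l) = s≤s (s≤s (ev-mono l))

ridge-sound : ∀ q m {τ} → τ ∈ ∂ (Ball (3 + ev q) (⌈ 3 + ev q /2⌉ ∸ 1) m) →
  ∃[ β ] (β ∈ Ball (3 + ev q) (suc q) m × τ ⊆ β)
ridge-sound q m {τ} j = let β , β∈ , s , _ = ∂-sound (Ball (3 + ev q) (suc q) m)
                                (subst (λ i → τ ∈ ∂ (Ball (3 + ev q) i m)) (⌊ev/2⌋ (suc q)) j) in β , β∈ , s

module Bounds (c : ℕ) where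

  far-neg : ∀ {A} → AllPairs (Far c) A → AllPairs (Far c) (negF A)
  far-neg f = AllPairs.map⁺ (AllPairs.map {R = Far c} {S = λ a b → Far c (- a) (- b)}
    (λ {a} {b} → [ (λ l → inj₁ (subst₂ (λ i j → i + c < j) (sym (ℤ.∣-i∣≡∣i∣ a)) (sym (ℤ.∣-i∣≡∣i∣ b)) l))
                 , (λ l → inj₂ (subst₂ (λ i j → i + c < j) (sym (ℤ.∣-i∣≡∣i∣ b)) (sym (ℤ.∣-i∣≡∣i∣ a)) l)) ]′) f)

  far-≢ : ∀ {a b} → Far c a b → a ≢ b
  far-≢ {a} (inj₁ l) refl = ℕ.<⇒≱ l (ℕ.m≤m+n ∣ a ∣ c)
  far-≢ {a} (inj₂ l) refl = ℕ.<⇒≱ l (ℕ.m≤m+n ∣ a ∣ c)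

  not-far : ∀ {a b m} → Far c a b → ∣ a ∣ ≤ m → ∣ b ∣ ≤ m → m ≤ c → ⊥
  not-far {a} (inj₁ l) p q r = ℕ.<⇒≱ l (ℕ.≤-trans (ℕ.≤-trans q r) (ℕ.m≤n+m c ∣ a ∣))
  not-far {b = b} (inj₂ l) p q r = ℕ.<⇒≱ l (ℕ.≤-trans (ℕ.≤-trans p r) (ℕ.m≤n+m c ∣ b ∣))

  record Low (A : List ℤ) (m : ℕ) : Set where
    constructor low
    field
      {rest} : List ℤ
      rest⊆ : rest ⊆ A
      rest-far : AllPairs (Far c) rest
      rest-low : All (λ a → ∣ a ∣ + c ≤ m) rest
      long : length A ≤ suc (length rest)

  -- A far set meets the window (m - c, m] at most once.
  cut : ∀ {A m} → AllPairs (Far c) A → All (λ a → ∣ a ∣ ≤ m) A → Low A m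
  cut [] [] = low id [] [] z≤n
  cut {a ∷ A} {m} (f ∷ fs) (b ∷ bs) with ∣ a ∣ + c ≤? m
  ... | yes l = let low s g h k = cut fs bs in
    low (∷-mono s) (All.tabulate (All.lookup f ∘ s) ∷ g) (l ∷ h) (s≤s k)
  ... | no l = low there fs (All.tabulate λ {v} i → case All.lookup f i of λ
    { (inj₁ q) → ⊥-elim (l (ℕ.<⇒≤ (ℕ.<-≤-trans q (All.lookup bs i))))
    ; (inj₂ q) → ℕ.<⇒≤ (ℕ.<-≤-trans q b) }) ℕ.≤-refl

  data Cut (i : ℕ) (A : List ℤ) : Set where
    inSph : ∀ p m {Ψ} → p < i → suc (ev p) < m → Ψ ∈ Sph (suc (ev p)) m → A ⊆ Ψ → All (λ a → ∣ a ∣ < m) A → Cut i A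
    unit : ∀ u → ∣ u ∣ ≡ 1 → All (_≡ u) A → Cut i A

  -- From |a| + c ≤ m ≤ m′ + s and s < c follows |a| < m′, so no element of `A` lies in the window.
  -- The strict bound is kept in `Cut` to exclude the wrapping edges of a cycle later.
  coarse-cut : ∀ {i m s F A} → Coarse i m s F → s < c → A ⊆ F → All (λ a → ∣ a ∣ + c ≤ m) A → Cut i A
  coarse-cut {m = m} {s} {A = A} (inSph p m′ a b _ d e f) l t h = inSph p m′ a d e
    (λ {v} i → [ (λ q → ⊥-elim (ℕ.<⇒≱ q (ℕ.<⇒≤ (below i)))) , id ]′ (f (t i)))
    (All.tabulate below)
    where
    below : ∀ {v} → v ∈ A → ∣ v ∣ < m′
    below {v} i = ℕ.+-cancelʳ-< s ∣ v ∣ m′ (ℕ.<-≤-trans (ℕ.+-monoʳ-< ∣ v ∣ l) (ℕ.≤-trans (All.lookup h i) b))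
  coarse-cut {m = m} {s} {A = A} (unit m′ u a b _ f) l t h = unit u a (All.tabulate λ {v} i →
    [ (λ q → ⊥-elim (ℕ.<⇒≱ q (ℕ.<⇒≤ (ℕ.+-cancelʳ-< s ∣ v ∣ m′ (ℕ.<-≤-trans (ℕ.+-monoʳ-< ∣ v ∣ l) (ℕ.≤-trans
        (All.lookup h i) b))))))
    , id ]′ (f (t i)))

  -- Here `m` is the level at which the facet was created; facets of the initial cross-polytope are
  -- `small`. The window 4 + 2q is that of the ball, d = 3 + 2q, enlarged by the new vertex.
  data Shape (q n : ℕ) (F : Face) : Set where
    small : All (λ v → ∣ v ∣ ≤ 4 + ev q) F → Shape q n F
    peel : ∀ m → m ≤ n → All (λ v → ∣ v ∣ ≤ m) F → Coarse (suc q) m (4 + ev q) F → Shape q n F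

  Sph-shape : ∀ q n {F} → suc (ev (suc q)) < n → F ∈ Sph (suc (ev (suc q))) n → Shape q n F
  Sph-shape q (suc m) l k with Sph-sound (suc (ev q)) m k
  ... | cross _ j = small (proj₂ (crossBd-size (4 + ev q) j))
  ... | stepped l′ (old j _ _) with Sph-shape q m l′ j
  ... | small a = small a
  ... | peel m′ a b d = peel m′ (ℕ.m≤n⇒m≤1+n a) b d
  Sph-shape q (suc m) l k | stepped l′ (top⁺ j) with ridge-sound q m j
  ... | β , β∈ , s = peel (suc m) ℕ.≤-refl
    (proj₂ (Sph-size (suc (ev (suc q))) (suc m) k) l)
    (Coarse-∷ refl (Coarse-⊆ s (Ball-coarse (3 + ev q) (suc q) m l′ β∈)))
  Sph-shape q (suc m) l k | stepped l′ (top⁻ {τ} j) with ridge-sound q m j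
  ... | β , β∈ , s = peel (suc m) ℕ.≤-refl
    (proj₂ (Sph-size (suc (ev (suc q))) (suc m) k) l)
    (Coarse-∷ refl (subst (Coarse (suc q) m (3 + ev q)) (negF-involutive τ)
      (Coarse-neg (Coarse-⊆ s (Ball-coarse (3 + ev q) (suc q) m l′ β∈)))))

  -- All edges except the two wrapping ones join consecutive absolute values.
  edge-far : ∀ {m F a b} → 0 < c → CycleEdge m F → a ∈ F → b ∈ F → ∣ a ∣ + c < ∣ b ∣ → ∣ a ∣ ≡ 1 × ∣ b ∣ ≡ suc m
  edge-far {m} {F} {a} {b} c>0 e i j l = go e i j
    where
    l′ : suc (suc ∣ a ∣) ≤ ∣ b ∣
    l′ = ℕ.≤-trans (s≤s (subst (_≤ ∣ a ∣ + c) (ℕ.+-comm ∣ a ∣ 1) (ℕ.+-monoʳ-≤ ∣ a ∣ c>0))) l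
    bad : ∀ {x y : ℕ} → ∣ a ∣ ≡ x → ∣ b ∣ ≡ y → y ≤ suc x → ⊥
    bad p q r = ℕ.<⇒≱ (subst₂ (λ x y → suc (suc x) ≤ y) p q l′) r
    go : CycleEdge m F → a ∈ F → b ∈ F → ∣ a ∣ ≡ 1 × ∣ b ∣ ≡ suc m
    go (up _) (here refl) (here refl) = ⊥-elim (bad refl refl (ℕ.n≤1+n _))
    go (up _) (here refl) (there (here refl)) = ⊥-elim (bad refl refl ℕ.≤-refl)
    go (up _) (there (here refl)) (here refl) = ⊥-elim (bad refl refl (ℕ.m≤n⇒m≤1+n (ℕ.n≤1+n _)))
    go (up _) (there (here refl)) (there (here refl)) = ⊥-elim (bad refl refl (ℕ.n≤1+n _))
    go (down _) (here refl) (here refl) = ⊥-elim (bad refl refl (ℕ.n≤1+n _))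
    go (down _) (here refl) (there (here refl)) = ⊥-elim (bad refl refl ℕ.≤-refl)
    go (down _) (there (here refl)) (here refl) = ⊥-elim (bad refl refl (ℕ.m≤n⇒m≤1+n (ℕ.n≤1+n _)))
    go (down _) (there (here refl)) (there (here refl)) = ⊥-elim (bad refl refl (ℕ.n≤1+n _))
    go wrap⁺ (here refl) (here refl) = ⊥-elim (bad refl refl (ℕ.n≤1+n _))
    go wrap⁺ (here refl) (there (here refl)) = ⊥-elim (bad refl refl (s≤s z≤n))
    go wrap⁺ (there (here refl)) (here refl) = refl , refl
    go wrap⁺ (there (here refl)) (there (here refl)) = ⊥-elim (bad refl refl (ℕ.n≤1+n _))
    go wrap⁻ (here refl) (here refl) = ⊥-elim (bad refl refl (ℕ.n≤1+n _))
    go wrap⁻ (here refl) (there (here refl)) = ⊥-elim (bad refl refl (s≤s z≤n))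
    go wrap⁻ (there (here refl)) (here refl) = refl , refl
    go wrap⁻ (there (here refl)) (there (here refl)) = ⊥-elim (bad refl refl (ℕ.n≤1+n _))

  -- Peeling the facet at its creation level costs at most one element of `A`; the rest lies in a
  -- sphere with smaller p or consists of copies of a single unit. For p = 0 the wrapping edges join
  -- two far vertices, hence the last hypothesis; after a peel it holds by the strict bound in
  -- `Cut`. The index may drop by more than one, so `fuel` drives the recursion.
  far-size : ∀ fuel p n {F A} → p < fuel → ev (suc p) < c → suc (ev p) < n → F ∈ Sph (suc (ev p)) n → A ⊆ F →
    AllPairs (Far c) A → 2 + p ≤ length A →
    (1 ≤ p ⊎ All (λ a → ∣ a ∣ < n) A ⊎ All (λ a → 1 < ∣ a ∣) A) → ⊥
  far-size (suc fuel) zero (suc m) {F} {a ∷ b ∷ A} l lc ln k s ((f ∷ _) ∷ _) _ (inj₂ r) = case f of λ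
    { (inj₁ q) → let x , y = edge-far (ℕ.<-trans (s≤s z≤n) lc) (cycle-sound m k) (s (here refl)) (s (there (here refl))) q in
        case r of λ { (inj₁ (_ ∷ z ∷ _)) → ℕ.<-irrefl y z ; (inj₂ (z ∷ _)) → ℕ.<-irrefl (sym x) z }
    ; (inj₂ q) → let x , y = edge-far (ℕ.<-trans (s≤s z≤n) lc) (cycle-sound m k) (s (there (here refl))) (s (here refl)) q in
        case r of λ { (inj₁ (z ∷ _)) → ℕ.<-irrefl y z ; (inj₂ (_ ∷ z ∷ _)) → ℕ.<-irrefl (sym x) z } }
  far-size (suc fuel) zero (suc m) {F} {a ∷ []} l lc ln k s _ (s≤s ()) _
  far-size (suc fuel) (suc q) n {F} {A} l lc ln k s f la r with Sph-shape q n ln k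
  far-size (suc fuel) (suc q) n {F} {a ∷ b ∷ A} l lc ln k s ((f ∷ _) ∷ _) la r | small h =
    not-far {a} {b} f (All.lookup h (s (here refl))) (All.lookup h (s (there (here refl)))) (ℕ.<⇒≤ lc)
  far-size (suc fuel) (suc q) n {F} {a ∷ []} l lc ln k s f (s≤s ()) r | small h
  far-size (suc fuel) (suc q) n {F} {A} l lc ln k s f la r | peel m _ h co with cut f (All.tabulate
      (All.lookup h ∘ s))
  ... | low rs rf rl long with coarse-cut co lc (s ∘ rs) rl
  ... | inSph p m′ p< lm j t st = far-size fuel p m′ (ℕ.<-≤-trans p< (ℕ.≤-pred l))
        (ℕ.≤-<-trans (ev-mono (ℕ.m≤n⇒m≤1+n p<)) lc) lm j t rf
        (ℕ.≤-trans (s≤s p<) (ℕ.≤-pred (ℕ.≤-trans la long))) (inj₂ (inj₁ st))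
  far-size (suc fuel) (suc q) n {F} {A} l lc ln k s f la r | peel m _ h co | low {a ∷ b ∷ R} rs
      ((g ∷ _) ∷ _) rl long | unit u _ (x ∷ y ∷ _) =
    far-≢ g (trans x (sym y))
  far-size (suc fuel) (suc q) n {F} {A} l lc ln k s f la r | peel m _ h co | low {[]} rs rf rl long | unit u _ _ = ℕ.<⇒≱ (ℕ.≤-trans (s≤s (s≤s z≤n)) la) long
  far-size (suc fuel) (suc q) n {F} {A} l lc ln k s f la r | peel m _ h co | low {a ∷ []} rs rf rl long | unit u _ _ = ℕ.<⇒≱ (ℕ.≤-trans (s≤s (s≤s (s≤s z≤n))) la) long

  -- The sphere behind a coarse facet of index i has p < i and holds at most p + 1 far elements
  -- below its top; the case of a unit is excluded by 1 < |a|.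
  far-Coarse : ∀ i {m s F A} → Coarse i m s F → s < c → ev i < c → A ⊆ F → AllPairs (Far c) A →
    All (λ a → ∣ a ∣ + c ≤ m) A → All (λ a → 1 < ∣ a ∣) A → i < length A → ⊥
  far-Coarse i co sc ic t f h o l with coarse-cut co sc t h
  ... | inSph p m′ p< lm j t′ st = far-size (suc p) p m′ ℕ.≤-refl (ℕ.≤-<-trans (ev-mono p<) ic) lm j t′ f
        (ℕ.≤-trans (s≤s p<) l) (inj₂ (inj₁ st))
  far-Coarse i co sc ic t f h (o ∷ _) l | unit u eq (refl ∷ _) = ℕ.<-irrefl (sym eq) o

  data Succ : ℤ → ℤ → Set where
    succ⁺ : ∀ {i} → Succ (+ suc i) (+ suc (suc i))
    succ⁻ : ∀ {i} → Succ -[1+ i ] -[1+ suc i ]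

  -- The peeling of `far-size` removes at most one element of `G` each time and never `x` or `y`,
  -- which lie more than c below all of `G`. In the final cycle |y| < n rules out the wrapping
  -- edges, so the edge joins consecutive vertices.
  forced-succ : ∀ fuel p n {F x y G} → p < fuel → ev (suc p) < c → suc (ev p) < n → F ∈ Sph (suc (ev p)) n →
    x ∷ y ∷ G ⊆ F → x ≢ y → ∣ x ∣ ≤ ∣ y ∣ → ∣ y ∣ < n → AllPairs (Far c) G → All (λ g → ∣ y ∣ + c < ∣ g ∣) G →
    p ≤ length G → Succ x y
  forced-succ (suc fuel) zero (suc m) {F} {x} {y} l lc ln k s x≢y le yn f h lg =
    go (cycle-sound m k) (s (here refl)) (s (there (here refl)))
    where
    go : CycleEdge m F → x ∈ F → y ∈ F → Succ x y
    go (up _) (here refl) (here refl) = ⊥-elim (x≢y refl)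
    go (up _) (here refl) (there (here refl)) = succ⁺
    go (up _) (there (here refl)) (here refl) = ⊥-elim (ℕ.<-irrefl refl le)
    go (up _) (there (here refl)) (there (here refl)) = ⊥-elim (x≢y refl)
    go (down _) (here refl) (here refl) = ⊥-elim (x≢y refl)
    go (down _) (here refl) (there (here refl)) = succ⁻
    go (down _) (there (here refl)) (here refl) = ⊥-elim (ℕ.<-irrefl refl le)
    go (down _) (there (here refl)) (there (here refl)) = ⊥-elim (x≢y refl)
    go wrap⁺ (here refl) _ = ⊥-elim (ℕ.<⇒≱ yn le)
    go wrap⁺ (there (here refl)) (here refl) = ⊥-elim (ℕ.<-irrefl refl yn)
    go wrap⁺ (there (here refl)) (there (here refl)) = ⊥-elim (x≢y refl)
    go wrap⁻ (here refl) _ = ⊥-elim (ℕ.<⇒≱ yn le)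
    go wrap⁻ (there (here refl)) (here refl) = ⊥-elim (ℕ.<-irrefl refl yn)
    go wrap⁻ (there (here refl)) (there (here refl)) = ⊥-elim (x≢y refl)
  forced-succ (suc fuel) (suc q) n {F} {x} {y} {g ∷ G} l lc ln k s x≢y le yn f (h ∷ hs) lg with Sph-shape q n ln k
  ... | small b = ⊥-elim (ℕ.<⇒≱ h (ℕ.≤-trans (ℕ.≤-trans (All.lookup b (s (there (there (here refl))))) (ℕ.<⇒≤ lc))
      (ℕ.m≤n+m c ∣ y ∣)))
  ... | peel m _ b co with cut f (All.tabulate (λ i → All.lookup b (s (there (there i)))))
  ... | low rs rf rl long with coarse-cut co lc (s ∘ ∷-mono (∷-mono rs)) (x+c≤m ∷ y+c≤m ∷ rl)
    where
    y+c≤m : ∣ y ∣ + c ≤ m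
    y+c≤m = ℕ.<⇒≤ (ℕ.<-≤-trans h (All.lookup b (s (there (there (here refl))))))
    x+c≤m : ∣ x ∣ + c ≤ m
    x+c≤m = ℕ.≤-trans (ℕ.+-monoˡ-≤ c le) y+c≤m
  ... | unit u _ (e ∷ e′ ∷ _) = ⊥-elim (x≢y (trans e (sym e′)))
  ... | inSph p m′ p< lm j t (_ ∷ st ∷ _) = forced-succ fuel p m′ (ℕ.<-≤-trans p< (ℕ.≤-pred l))
        (ℕ.≤-<-trans (ev-mono (ℕ.m≤n⇒m≤1+n p<)) lc) lm j t x≢y le st rf
        (All.tabulate (All.lookup (h ∷ hs) ∘ rs)) (ℕ.≤-trans (ℕ.≤-pred p<) (ℕ.≤-pred (ℕ.≤-trans lg long)))

-- Facets that contain many far vertices of small absolute value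

n≢ᵇsuc-n : ∀ n → (n ≡ᵇ suc n) ≡ false
n≢ᵇsuc-n zero = refl
n≢ᵇsuc-n (suc n) = n≢ᵇsuc-n n

n≡ᵇn : ∀ n → (n ≡ᵇ n) ≡ true
n≡ᵇn zero = refl
n≡ᵇn (suc n) = n≡ᵇn n

BallAny-low : ∀ q m → BallAny (suc (ev q)) q m ≡ Ball (suc (ev q)) q m
BallAny-low q m rewrite isOdd-ev q | ⌊ev/2⌋ q | n≢ᵇsuc-n q = refl

BallAny-top : ∀ q m → BallAny (suc (ev q)) (suc q) m ≡ Sph (suc (ev q)) m ∖ Ball (suc (ev q)) q m
BallAny-top q m = trans whole-test (cong (Sph (suc (ev q)) m ∖_) (BallAny-low q m))
  where
  whole-test : BallAny (suc (ev q)) (suc q) m ≡ Sph (suc (ev q)) m ∖ BallAny (suc (ev q)) q m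
  whole-test rewrite isOdd-ev q | ⌊ev/2⌋ q | n≡ᵇn q = refl

BallAny-even : ∀ q i m → BallAny (2 + ev q) i m ≡ Ball (2 + ev q) i m
BallAny-even q i m rewrite isOdd-ev q = refl

module Extension (c : ℕ) where
  open Bounds c

  -- The result of two plus steps of the ball recursion, from dimension 2q + 3 down to the
  -- complement ball in dimension 2q + 1.
  data Peeled (q : ℕ) : ℕ → Face → Set where
    peeled : ∀ {m Ψ} → Ψ ∈ Sph (suc (ev q)) m → Peeled q (2 + m) (+ (2 + m) ∷ + (1 + m) ∷ Ψ)

  -- A minus step lowers the index of the ball, which leaves no room for q + 1 far elements.
  Ball-peel : ∀ q {m β G} → ev (2 + q) < c → 3 + ev q < m → β ∈ Ball (3 + ev q) (suc q) m →
    G ⊆ β → AllPairs (Far c) G → All (λ g → ∣ g ∣ + c ≤ m) G → All (λ g → 1 < ∣ g ∣) G → q < length G →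
    Peeled q m β
  Ball-peel q {suc zero} lc (s≤s ())
  Ball-peel q {suc (suc m)} lc lm k s f h o lg with Ball-sound (suc (ev q)) (suc q) (suc m) k
  ... | minus refl j = ⊥-elim (far-Coarse q
    (Coarse-∷ refl (Coarse-neg (BallAny-coarse (2 + ev q) q (suc m) (ℕ.≤-pred lm) j)))
    (ℕ.≤-trans (ℕ.n≤1+n _) lc) (ℕ.≤-<-trans (ev-mono (ℕ.m≤n+m q 2)) lc) s f h o lg)
  ... | plus j with Ball-sound (ev q) (suc q) m (subst (_ ∈_) (BallAny-even q (suc q) (suc m)) j)
  ... | minus refl j′ = ⊥-elim (far-Coarse q
    (Coarse-∷ refl (Coarse-∷ refl (Coarse-neg (BallAny-coarse (suc (ev q)) q m (ℕ.≤-pred (ℕ.≤-pred lm)) j′))))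
    (ℕ.≤-trans (ℕ.n≤1+n _) lc) (ℕ.≤-<-trans (ev-mono (ℕ.m≤n+m q 2)) lc) s f h o lg)
  ... | plus j′ = peeled (proj₁ (∈-∖⁻ (Sph (suc (ev q)) m) (Ball (suc (ev q)) q m) (subst (_ ∈_)
      (BallAny-top q m) j′)))

  -- By `Ball-peel`, `x` is m, m - 1 or a vertex of a facet of the sphere of dimension 2q + 1. In
  -- the last case `x` and `G` would be q + 2 far vertices there, against `far-size`.
  Ball-top-two : ∀ q {m β G x} → ev (2 + q) < c → 3 + ev q < m → β ∈ Ball (3 + ev q) (suc q) m →
    x ∷ G ⊆ β → AllPairs (Far c) G → All (λ g → ∣ g ∣ + c < ∣ x ∣) G → All (λ g → 1 < ∣ g ∣) G → q < length G →
    ∃[ i ] (x ≡ + suc i × m ≤ 2 + i)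
  Ball-top-two q {m} {β} {g ∷ G} {x} lc lm k s f (h ∷ hs) (o ∷ os) lg
    with Ball-peel q lc lm k (s ∘ there) f
      (All.map (λ l → ℕ.<⇒≤ (ℕ.<-≤-trans l (All.lookup (proj₂ (Ball-size _ _ m k) lm) (s (here refl))))) (h ∷ hs))
          (o ∷ os) lg
  ... | peeled {m′} {Ψ} j with s (here refl)
  ... | here refl = _ , refl , ℕ.n≤1+n _
  ... | there (here refl) = _ , refl , ℕ.≤-refl
  ... | there (there i) = ⊥-elim (far-size (suc q) q m′ ℕ.≤-refl (ℕ.<-trans (ℕ.n<1+n _) (ℕ.<-trans (ℕ.n<1+n _) lc))
        (ℕ.≤-pred (ℕ.≤-pred lm)) j (∷-⊆ i G⊆Ψ) (All.map inj₂ (h ∷ hs) ∷ f) (s≤s lg)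
        (inj₂ (inj₂ (ℕ.<-≤-trans o (ℕ.≤-trans (ℕ.m≤m+n ∣ g ∣ c) (ℕ.<⇒≤ h)) ∷ o ∷ os))))
    where
    x≤m : ∣ x ∣ ≤ m′
    x≤m = All.lookup (proj₂ (Sph-size (suc (ev q)) m′ j) (ℕ.≤-pred (ℕ.≤-pred lm))) i
    low′ : ∀ {v} → v ∈ g ∷ G → ∣ v ∣ < m′
    low′ {v} v∈ = ℕ.<-≤-trans (ℕ.≤-<-trans (ℕ.m≤m+n ∣ v ∣ c) (All.lookup (h ∷ hs) v∈)) x≤m
    G⊆Ψ : g ∷ G ⊆ Ψ
    G⊆Ψ {v} v∈ with s (there v∈)
    ... | here refl = ⊥-elim (ℕ.<⇒≱ (low′ v∈) (ℕ.≤-trans (ℕ.n≤1+n _) (ℕ.n≤1+n _)))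
    ... | there (here refl) = ⊥-elim (ℕ.<⇒≱ (low′ v∈) (ℕ.n≤1+n _))
    ... | there (there r) = r

  drop-top : ∀ {m t τ a y G} → ∣ t ∣ ≡ suc m → + a ∷ y ∷ G ⊆ t ∷ τ → 2 + a ≤ ∣ y ∣ → ∣ y ∣ ≤ suc m →
    All (λ g → ∣ g ∣ + c < a) G → + a ∷ G ⊆ τ
  drop-top {m} {t} {τ} {a} {y} {G} et s ay ym h i with v∈
    where
    v∈ : _ ∈ t ∷ τ
    v∈ = s (case i of λ { (here e) → here e ; (there j) → there (there j) })
  ... | there j = j
  ... | here refl = ⊥-elim (ℕ.<-irrefl et (ℕ.≤-<-trans (t≤a i) (ℕ.<-≤-trans (ℕ.n<1+n a) (ℕ.≤-trans (ℕ.n≤1+n _)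
      (ℕ.≤-trans ay ym)))))
    where
    t≤a : ∀ {v} → v ∈ + a ∷ G → ∣ v ∣ ≤ a
    t≤a (here refl) = ℕ.≤-refl
    t≤a {v} (there j) = ℕ.≤-trans (ℕ.m≤m+n ∣ v ∣ c) (ℕ.<⇒≤ (All.lookup h j))

  -- Go back to the level m + 1 at which the facet was created. By `drop-top`, a and `G` avoid the
  -- new vertex and lie in a facet of the ball or of its negative. The negative is impossible, since
  -- `Ball-top-two` would make -a positive. Otherwise a ≥ m - 1, so |y| ≥ a + 2 leaves only the new
  -- vertex m + 1 = a + 2 for `y`.
  forced-skip : ∀ q n {F a y G} → ev (2 + q) < c → 3 + ev q < n → F ∈ Sph (3 + ev q) n →
    + a ∷ y ∷ G ⊆ F → 2 + a ≤ ∣ y ∣ → AllPairs (Far c) G → All (λ g → ∣ g ∣ + c < a) G →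
    All (λ g → 1 < ∣ g ∣) G → q < length G → y ≡ + (2 + a)
  forced-skip q (suc m) {G = g ∷ G} lc ln k s ay f (h ∷ hs) o lg with Sph-sound (suc (ev q)) m k
  ... | cross _ j = ⊥-elim (ℕ.<⇒≱ (ℕ.<-≤-trans (ℕ.≤-<-trans (ℕ.m≤n+m c ∣ g ∣) h) (ℕ.≤-trans (ℕ.≤-trans (ℕ.n≤1+n _)
      (ℕ.n≤1+n _)) ay))
        (ℕ.≤-trans (All.lookup (proj₂ (crossBd-size (4 + ev q) j)) (s (there (here refl)))) (ℕ.<⇒≤ lc)))
  ... | stepped l (old j _ _) = forced-skip q m lc l j s ay f (h ∷ hs) o lg
  forced-skip q (suc m) {F} {a} {y} {g ∷ G} lc ln k s ay f h o lg | stepped l (top⁺ {τ} j)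
    with ridge-sound q m j
  ... | β , β∈ , t
    with Ball-top-two q lc l β∈ (t ∘ drop-top refl s ay (y≤top (s (there (here refl)))) h) f h o lg
    where
    y≤top : ∀ {v} → v ∈ F → ∣ v ∣ ≤ suc m
    y≤top = All.lookup (proj₂ (Sph-size (3 + ev q) (suc m) k) ln)
  ... | i , refl , m≤ with s (there (here refl))
  ... | here refl = cong +_ (cong suc (ℕ.≤-antisym m≤ (ℕ.≤-pred ay)))
  ... | there r = ⊥-elim (ℕ.<⇒≱ (ℕ.<-≤-trans (ℕ.n<1+n _) ay)
        (ℕ.≤-trans (All.lookup (proj₂ (Ball-size _ _ m β∈) l) (t r)) m≤))
  forced-skip q (suc m) {F} {a} {y} {g ∷ G} lc ln k s ay f h o lg | stepped l (top⁻ {τ} j)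
    with ridge-sound q m j
  ... | β , β∈ , t
    with Ball-top-two q {G = negF (g ∷ G)} {x = - (+ a)} lc l β∈
      (t ∘ negF-⊆ (drop-top refl s ay (y≤top (s (there (here refl)))) h))
      (far-neg f)
      (All.map⁺ (All.map (λ {v} → subst₂ (λ i j → i + c < j) (sym (ℤ.∣-i∣≡∣i∣ v)) (sym (ℤ.∣-i∣≡∣i∣ (+ a)))) h))
      (All.map⁺ (All.map (λ {v} → subst (1 <_) (sym (ℤ.∣-i∣≡∣i∣ v))) o))
      (subst (q <_) (sym (List.length-map -_ (g ∷ G))) lg)
    where
    y≤top : ∀ {v} → v ∈ F → ∣ v ∣ ≤ suc m
    y≤top = All.lookup (proj₂ (Sph-size (3 + ev q) (suc m) k) ln)
  ... | i , e , _ = case neg-+ e of λ ()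
    where
    neg-+ : ∀ {a i} → - (+ a) ≡ + suc i → ⊥
    neg-+ {zero} ()
    neg-+ {suc a} ()

-- Existence of facets made of consecutive pairs

ridge-complete : ∀ q m {τ} → 4 + ev q ≤ m → τ ∈F ∂ (Ball (3 + ev q) (suc q) m) → + suc m ∷ τ ∈F Sph (3 + ev q) (suc m)
ridge-complete q m l (ρ , ρ∈ , e) = _ , Sph-complete (suc (ev q)) m
  (stepped l (top⁺ (subst (λ i → ρ ∈ ∂ (Ball (3 + ev q) i m)) (sym (⌊ev/2⌋ (suc q))) ρ∈))) , ∷-≋ e

-- A ball facet containing `F` or its negative would equal it by size, yet it has a vertex of
-- absolute value `w` and `F` has none. So `F` is not removed.
survive : ∀ q n w {F} → 4 + ev q ≤ n → (∀ {H} → H ∈ Ball (3 + ev q) (suc q) n → ∃[ v ] (v ∈ H × ∣ v ∣ ≡ w)) →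
  Distinct F → length F ≡ 4 + ev q → All (λ v → ∣ v ∣ ≢ w) F → F ∈F Sph (3 + ev q) n → F ∈F Sph (3 + ev q) (suc n)
survive q n w {F} l meets d len avoid (G , G∈ , e) = G , Sph-complete (suc (ev q)) n
  (stepped l (subst (λ i → StepFace n (Sph (3 + ev q) n) (Ball (3 + ev q) i n) G) (sym (⌊ev/2⌋ (suc q)))
    (old G∈ (λ h s → bad h d len avoid (s ∘ proj₁ e))
            (λ h s → bad h (AllPairs.map⁺ (AllPairs.map (λ n e → n (ℤ.neg-injective e)) d))
                           (trans (List.length-map -_ F) len)
                           (All.map⁺ (All.map (λ {v} n e → n (trans (sym (ℤ.∣-i∣≡∣i∣ v)) e)) avoid))
                           (s ∘ negF-⊆ (proj₁ e)))))) , e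
  where
  bad : ∀ {K H} → H ∈ Ball (3 + ev q) (suc q) n → Distinct K → length K ≡ 4 + ev q → All (λ v → ∣ v ∣ ≢ w) K →
      K ⊆ H → ⊥
  bad h dK lK aK s = let v , v∈ , ev = meets h in All.lookup aK
    (proj₁ (distinct-⊆-≋ dK s (ℕ.≤-reflexive (trans (proj₁ (Ball-size _ _ n h)) (sym lK)))) v∈) ev

Ball-meets-top : ∀ e i m {H} → H ∈ Ball (2 + e) i (suc m) → ∃[ v ] (v ∈ H × ∣ v ∣ ≡ suc m)
Ball-meets-top e i m k with Ball-sound e i m k
... | plus _ = _ , here refl , refl
... | minus _ _ = _ , here refl , refl

Ball-meets-second : ∀ q i m {H} → H ∈ Ball (3 + ev q) i (2 + m) → ∃[ v ] (v ∈ H × ∣ v ∣ ≡ suc m)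
Ball-meets-second q i m k with Ball-sound (suc (ev q)) i (suc m) k
... | plus j = let v , v∈ , e = Ball-meets-top (ev q) i m (subst (_ ∈_) (BallAny-even q i (suc m)) j) in v , there v∈ , e
... | minus {i′} refl j = let v , v∈ , e = Ball-meets-top (ev q) i′ m (subst (_ ∈_) (BallAny-even q i′ (suc m)) j) in
  - v , there (∈-negF v∈) , trans (ℤ.∣-i∣≡∣i∣ v) e

module Towers (c : ℕ) where
  open Bounds c
  open Extension c

  -- `F` stands for a facet made of q + 1 pairs separated by large gaps, and `A` for the upper
  -- vertices of the pairs, to which the upper bounds apply. The facet persists at all levels from
  -- `t` on, since the construction of the next pair uses it at a higher level.
  record Tower (q t : ℕ) (F A : List ℤ) : Set where
    field
      size : length F ≡ 2 + ev q
      distinct : Distinct F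
      bounded : All (λ v → ∣ v ∣ ≤ t) F
      nonzero : All (λ v → 1 ≤ ∣ v ∣) F
      A⊆F : A ⊆ F
      A-far : AllPairs (Far c) A
      A-big : All (λ a → 1 < ∣ a ∣) A
      A-size : length A ≡ suc q
      facet : ∀ {n} → t ≤ n → suc (ev q) < n → F ∈F Sph (suc (ev q)) n

  open Tower public

  tower-base : ∀ i → Tower 0 (2 + i) (+ suc i ∷ + (2 + i) ∷ []) (+ (2 + i) ∷ [])
  tower-base i = record
    { size = refl
    ; distinct = ((λ ()) ∷ []) ∷ [] ∷ []
    ; bounded = ℕ.n≤1+n _ ∷ ℕ.≤-refl ∷ []
    ; nonzero = s≤s z≤n ∷ s≤s z≤n ∷ []
    ; A⊆F = there
    ; A-far = [] ∷ []
    ; A-big = s≤s (s≤s z≤n) ∷ []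
    ; A-size = refl
    ; facet = λ { {suc n} (s≤s l) _ → _ , cycle-complete n (up l) , id , id }
    }

  module _ {q t m F A} (T : Tower q t F A) (lc : ev (2 + q) < c) (gap : t + c < m) where

    private
      t≤m : t ≤ m
      t≤m = ℕ.≤-trans (ℕ.m≤m+n t c) (ℕ.<⇒≤ gap)

      dim<m : 4 + ev q < m
      dim<m = ℕ.<-trans lc (ℕ.≤-<-trans (ℕ.m≤n+m c t) gap)

      F≤m : ∀ {v} → v ∈ F → ∣ v ∣ ≤ m
      F≤m i = ℕ.≤-trans (All.lookup (bounded T) i) t≤m

      A-low : ∀ j → All (λ a → ∣ a ∣ + c ≤ j + m) A
      A-low j = All.tabulate λ i → ℕ.≤-trans (ℕ.+-monoˡ-≤ c (All.lookup (bounded T) (A⊆F T i)))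
        (ℕ.≤-trans (ℕ.<⇒≤ gap) (ℕ.m≤n+m m j))

      full : Face
      full = + (2 + m) ∷ + (1 + m) ∷ F

    -- The q + 1 far vertices of `A` force two plus steps by `Ball-peel`; what remains is a facet of
    -- the smaller sphere containing `F`, hence equal to it by size.
    full-unique : ∀ {H} → H ∈ Ball (3 + ev q) (suc q) (2 + m) → F ⊆ H → H ≋ full
    full-unique {H} h s with Ball-peel q lc (ℕ.≤-trans (ℕ.<⇒≤ dim<m) (ℕ.m≤n+m m 2)) h (s ∘ A⊆F T)
                               (A-far T) (A-low 2) (A-big T) (subst (q <_) (sym (A-size T)) ℕ.≤-refl)
    ... | peeled {Ψ = Ψ} j = ∷-≋ (∷-≋ (distinct-⊆-≋ (distinct T) F⊆Ψ
            (ℕ.≤-reflexive (trans (proj₁ (Sph-size (suc (ev q)) m j)) (sym (size T))))))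
      where
      F⊆Ψ : F ⊆ Ψ
      F⊆Ψ i with s i
      ... | here refl = ⊥-elim (ℕ.<⇒≱ (ℕ.n<1+n (suc m)) (ℕ.m≤n⇒m≤1+n (F≤m i)))
      ... | there (here refl) = ⊥-elim (ℕ.<-irrefl refl (F≤m i))
      ... | there (there k) = k

    -- `F` is not in the ball of index q, which has room for only q far vertices while `A` has q +
    -- 1. So `F` lies in the complement ball, and two plus steps add m + 1 and m + 2.
    full∈Ball : ∃[ β ] (β ∈ Ball (3 + ev q) (suc q) (2 + m) × β ≋ full)
    full∈Ball with facet T t≤m (ℕ.<-trans (ℕ.≤-trans (ℕ.n≤1+n _) (ℕ.n≤1+n _)) dim<m)
    ... | Ψ , Ψ∈ , e = _ , ∈-++⁺ˡ (∈-map⁺ _ (subst (_ ∈_) (sym (BallAny-even q (suc q) (suc m)))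
        (∈-++⁺ˡ (∈-map⁺ _ (subst (Ψ ∈_) (sym (BallAny-top q m)) (∈-∖⁺ (Ball (suc (ev q)) q m) Ψ∈ λ h s →
          far-Coarse q (Ball-coarse (suc (ev q)) q m (ℕ.<-trans (ℕ.≤-trans (ℕ.n≤1+n _) (ℕ.n≤1+n _)) dim<m) h)
            (ℕ.<-trans (ℕ.≤-trans (ℕ.n≤1+n _) (ℕ.n≤1+n _)) lc) (ℕ.≤-<-trans (ev-mono (ℕ.m≤n+m q 2)) lc)
                (s ∘ proj₁ e ∘ A⊆F T) (A-far T) (A-low 0) (A-big T)
            (subst (q <_) (sym (A-size T)) ℕ.≤-refl)))))))
      , ≋-sym (∷-≋ (∷-≋ e))

    -- Dropping `v` from `full` leaves a ridge that contains `F`. By `full-unique` it lies in one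
    -- facet only, so it is on the boundary and is coned with m + 3.
    cap : ∀ v w → v ≢ w → m < ∣ v ∣ → m < ∣ w ∣ → full ≋ v ∷ w ∷ F → + (3 + m) ∷ w ∷ F ∈F Sph (3 + ev q) (3 + m)
    cap v w v≢w v> w> e = let β , β∈ , e′ = full∈Ball in
      ridge-complete q (2 + m) (ℕ.≤-trans (ℕ.<⇒≤ dim<m) (ℕ.m≤n+m m 2))
        (∂-complete _ β∈ (≋-trans e′ e)
          ((v≢w ∷ above v>) ∷ above w> ∷ distinct T)
          (λ h → trans (proj₁ (Ball-size (3 + ev q) (suc q) (2 + m) h)) (cong (λ l → suc (suc l)) (sym (size T))))
          λ h s → ≋-trans (full-unique h (s ∘ there)) (≋-sym e′))
      where
      above : ∀ {x} → m < ∣ x ∣ → All (x ≢_) F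
      above l = All.tabulate λ { i refl → ℕ.<⇒≱ l (F≤m i) }

    -- This provides the pair {n - 1, n} at the top level n = m + 3.
    tower-cap : + (3 + m) ∷ + (2 + m) ∷ F ∈F Sph (3 + ev q) (3 + m)
    tower-cap = cap (+ (1 + m)) (+ (2 + m)) (λ ()) ℕ.≤-refl (ℕ.n≤1+n _)
      ((λ { (here refl) → there (here refl) ; (there (here refl)) → here refl ; (there (there i)) → there (there i) })
      , (λ { (here refl) → there (here refl) ; (there (here refl)) → here refl ; (there (there i)) → there
          (there i) }))

    tower-step : Tower (suc q) (3 + m) (+ (3 + m) ∷ + (1 + m) ∷ F) (+ (3 + m) ∷ A)
    tower-step = record
      { size = len
      ; distinct = dist
      ; bounded = bnd
      ; nonzero = s≤s z≤n ∷ s≤s z≤n ∷ nonzero T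
      ; A⊆F = ∷-mono (there ∘ A⊆F T)
      ; A-far = All.tabulate (λ i → inj₂ (ℕ.≤-<-trans (All.lookup (A-low 0) i) (ℕ.m≤n+m (suc m) 2))) ∷ A-far T
      ; A-big = s≤s (s≤s z≤n) ∷ A-big T
      ; A-size = cong suc (A-size T)
      ; facet = λ {n} l _ → subst (λ n → _ ∈F Sph (3 + ev q) n) (ℕ.m∸n+n≡m l) (climb (n ∸ (3 + m)))
      }
      where
      len : length (+ (3 + m) ∷ + (1 + m) ∷ F) ≡ 4 + ev q
      len = cong (λ l → suc (suc l)) (size T)
      bnd : All (λ v → ∣ v ∣ ≤ 3 + m) (+ (3 + m) ∷ + (1 + m) ∷ F)
      bnd = ℕ.≤-refl ∷ ℕ.m≤n+m (suc m) 2 ∷ All.tabulate (λ i → ℕ.≤-trans (F≤m i) (ℕ.m≤n+m m 3))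
      dist : Distinct (+ (3 + m) ∷ + (1 + m) ∷ F)
      dist = ((λ ()) ∷ All.tabulate (λ { i refl → ℕ.<⇒≱ (F≤m i) (ℕ.m≤n+m m 2) }))
        ∷ All.tabulate (λ { i refl → ℕ.<-irrefl refl (F≤m i) }) ∷ distinct T
      climb : ∀ j → + (3 + m) ∷ + (1 + m) ∷ F ∈F Sph (3 + ev q) (j + (3 + m))
      climb zero = cap (+ (2 + m)) (+ (1 + m)) (λ ()) (ℕ.n≤1+n _) ℕ.≤-refl (id , id)
      -- The ball at level m + 3 shares the vertex m + 3 with the new facet, so the skipped vertex m
      -- + 2, met by all its facets up to sign, serves as witness.
      climb (suc zero) = survive q (3 + m) (2 + m) (ℕ.≤-trans (ℕ.<⇒≤ dim<m) (ℕ.m≤n+m m 3))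
        (Ball-meets-second q (suc q) (suc m)) dist len
        ((λ ()) ∷ (λ ()) ∷ All.tabulate (λ i e → ℕ.<⇒≱ (ℕ.m≤n+m (suc m) 1) (subst (_≤ m) e (F≤m i)))) (climb zero)
      -- From here on the top vertex of the ball exceeds all vertices of the facet.
      climb (suc (suc j)) = survive q (suc j + (3 + m)) (suc j + (3 + m))
        (ℕ.≤-trans (ℕ.<⇒≤ dim<m) (ℕ.≤-trans (ℕ.m≤n+m m 3) (ℕ.m≤n+m (3 + m) (suc j))))
        (Ball-meets-top (suc (ev q)) (suc q) (j + (3 + m))) dist len
        (All.map (λ l e → ℕ.<⇒≱ (s≤s (ℕ.m≤n+m (3 + m) j)) (subst (_≤ 3 + m) e l)) bnd)
        (climb (suc j))

-- Selecting generic faces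

-- The offset i runs over 0, ..., 2c from the truncated value |q| - c, so the list covers every
-- integer whose absolute value is within c of |q|.
nearPair : ℕ → ℤ → ℕ → List ℤ
nearPair c q i = + (∣ q ∣ ∸ c + i) ∷ - (+ (∣ q ∣ ∸ c + i)) ∷ []

near : ℕ → ℤ → List ℤ
near c q = concatMap (nearPair c q) (applyUpTo id (suc (c + c)))

concatMap-pair-length : ∀ {A : Set} (f g : A → ℤ) xs → length (concatMap (λ x → f x ∷ g x ∷ []) xs) ≡ length xs * 2
concatMap-pair-length f g [] = refl
concatMap-pair-length f g (x ∷ xs) = cong (λ l → suc (suc l)) (concatMap-pair-length f g xs)

near-length : ∀ c q → length (near c q) ≡ suc (c + c) * 2
near-length c q = trans (concatMap-pair-length _ _ (applyUpTo id (suc (c + c)))) (cong (_* 2)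
    (List.length-applyUpTo id (suc (c + c))))

∈-± : ∀ z → z ≡ + ∣ z ∣ ⊎ z ≡ - (+ ∣ z ∣)
∈-± (+ n) = inj₁ refl
∈-± -[1+ n ] = inj₂ refl

near-complete : ∀ c q {z} → z ∉ near c q → Far c z q
near-complete c q {z} z∉ with ∣ z ∣ + c <? ∣ q ∣ | ∣ q ∣ + c <? ∣ z ∣
... | yes l | _ = inj₁ l
... | no _ | yes l = inj₂ l
... | no a | no b = ⊥-elim (z∉ (∈-concatMap⁺ (nearPair c q) (lose (∈-applyUpTo⁺ id i<) (mem (∈-± z)))))
  where
  lo : ∣ q ∣ ∸ c ≤ ∣ z ∣
  lo = ℕ.m≤n+o⇒m∸n≤o ∣ q ∣ c (subst (∣ q ∣ ≤_) (ℕ.+-comm ∣ z ∣ c) (ℕ.≮⇒≥ a))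
  eq : ∣ q ∣ ∸ c + (∣ z ∣ ∸ (∣ q ∣ ∸ c)) ≡ ∣ z ∣
  eq = ℕ.m+[n∸m]≡n lo
  i< : ∣ z ∣ ∸ (∣ q ∣ ∸ c) < suc (c + c)
  i< = s≤s (ℕ.m≤n+o⇒m∸n≤o ∣ z ∣ (∣ q ∣ ∸ c) (ℕ.≤-trans (ℕ.≮⇒≥ b)
    (subst (∣ q ∣ + c ≤_) (ℕ.+-assoc (∣ q ∣ ∸ c) c c) (ℕ.+-monoˡ-≤ c (subst (∣ q ∣ ≤_) (ℕ.+-comm c (∣ q ∣ ∸ c))
        (ℕ.m≤n+m∸n ∣ q ∣ c))))))
  mem : z ≡ + ∣ z ∣ ⊎ z ≡ - (+ ∣ z ∣) → z ∈ nearPair c q (∣ z ∣ ∸ (∣ q ∣ ∸ c))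
  mem (inj₁ e) = here (trans e (cong +_ (sym eq)))
  mem (inj₂ e) = there (here (trans e (cong (λ n → - (+ n)) (sym eq))))

nearAll : ℕ → List ℤ → List ℤ
nearAll c = concatMap (near c)

nearAll-length : ∀ c Q → length (nearAll c Q) ≡ length Q * (suc (c + c) * 2)
nearAll-length c [] = refl
nearAll-length c (q ∷ Q) = trans (List.length-++ (near c q)) (cong₂ _+_ (near-length c q) (nearAll-length c Q))

nearAll-complete : ∀ c Q {z} → z ∉ nearAll c Q → All (Far c z) Q
nearAll-complete c [] z∉ = []
nearAll-complete c (q ∷ Q) z∉ = near-complete c q (z∉ ∘ ∈-++⁺ˡ) ∷ nearAll-complete c Q (z∉ ∘ ∈-++⁺ʳ (near c q))

InV : ℕ → ℤ → Set
InV n z = 1 ≤ ∣ z ∣ × ∣ z ∣ ≤ n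

neg-InV : ∀ {n} z → InV n z → InV n (- z)
neg-InV z (a , b) rewrite ℤ.∣-i∣≡∣i∣ z = a , b

IsFace : Complex → Face → Set
IsFace Δ σ = ∃[ F ] (F ∈ Δ × σ ⊆ F)

IsFace-⊆ : ∀ {Δ σ τ} → τ ⊆ σ → IsFace Δ σ → IsFace Δ τ
IsFace-⊆ s (F , F∈ , t) = F , F∈ , t ∘ s

∈F⇒IsFace : ∀ {Δ F} → F ∈F Δ → IsFace Δ F
∈F⇒IsFace (G , G∈ , s , _) = G , G∈ , s

record Symmetry (n : ℕ) (Δ : Complex) (ψ : ℤ → ℤ) : Set where
  field
    preserves-V : ∀ {z} → InV n z → InV n (ψ z)
    injective : ∀ {z w} → InV n z → InV n w → ψ z ≡ ψ w → z ≡ w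
    surjective : ∀ {w} → InV n w → ∃[ z ] (InV n z × ψ z ≡ w)
    preserves-faces : ∀ {σ} → All (InV n) σ → IsFace Δ σ → IsFace Δ (map ψ σ)

module _ {n : ℕ} {ψ : ℤ → ℤ} {Δ : Complex} (S : Symmetry n Δ ψ) where
  open Symmetry S

  avoid-or-hit : ∀ B w L → (∃[ g ] (w < g × g ≤ w + L × ψ (+ g) ∉ B)) ⊎ (∀ g → w < g → g ≤ w + L → ψ (+ g) ∈ B)
  avoid-or-hit B w zero = inj₂ λ g a b → ⊥-elim (ℕ.<⇒≱ a (subst (g ≤_) (ℕ.+-identityʳ w) b))
  avoid-or-hit B w (suc L) with avoid-or-hit B w L
  ... | inj₁ (g , a , b , d) = inj₁ (g , a , ℕ.≤-trans b (ℕ.+-monoʳ-≤ w (ℕ.n≤1+n L)) , d)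
  ... | inj₂ f with Any.any? (ℤ._≟_ (ψ (+ (w + suc L)))) B
  ... | no q = inj₁ (w + suc L , ℕ.m<m+n w (s≤s z≤n) , ℕ.≤-refl , q)
  ... | yes p = inj₂ λ g a b → case ℕ.m≤n⇒m<n∨m≡n b of λ
    { (inj₁ l) → f g a (ℕ.≤-pred (subst (suc g ≤_) (ℕ.+-suc w L) l)) ; (inj₂ refl) → p }

  -- `ψ` is injective on the `L` integers after `w`, so their images cannot all lie in the shorter
  -- list `B`.
  avoid : ∀ B w L → w + L ≤ n → length B < L → ∃[ g ] (w < g × g ≤ w + L × ψ (+ g) ∉ B)
  avoid B w L wl lB with avoid-or-hit B w L
  ... | inj₁ r = r
  ... | inj₂ f = ⊥-elim (ℕ.<⇒≱ lB (subst (_≤ length B) (List.length-applyUpTo img L) (distinct-⊆-length dist sub)))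
    where
    img : ℕ → ℤ
    img i = ψ (+ (suc w + i))
    inV : ∀ {i} → i < L → InV n (+ (suc w + i))
    inV {i} l = s≤s z≤n , ℕ.≤-trans (subst (_≤ w + L) (ℕ.+-suc w i) (ℕ.+-monoʳ-≤ w l)) wl
    dist : Distinct (applyUpTo img L)
    dist = AllPairs.applyUpTo⁺₁ img L λ {i} {j} i<j j<L e →
      ℕ.<-irrefl (ℕ.+-cancelˡ-≡ (suc w) i j (ℤ.+-injective (injective (inV (ℕ.<-trans i<j j<L)) (inV j<L) e))) i<j
    sub : applyUpTo img L ⊆ B
    sub i with ∈-applyUpTo⁻ img i
    ... | j , j<L , refl = f (suc w + j) (s≤s (ℕ.m≤m+n w j)) (subst (_≤ w + L) (ℕ.+-suc w j) (ℕ.+-monoʳ-≤ w j<L))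

-- A window may depend on the vertices chosen before it, so the images of the chosen vertices
-- under a symmetry can be kept far from each other one vertex at a time.
Extends : (n : ℕ) (Δ : Complex) (b L r : ℕ) → List ℤ → Set
Extends n Δ b L zero S = IsFace Δ S
Extends n Δ b L (suc r) S = ∃[ w ] (b ≤ w × w + L ≤ n × (∀ g → w < g → g ≤ w + L → Extends n Δ b L r (+ g ∷ S)))

-- Distances are imposed on images under `ψ`, because the upper bounds are applied to the image
-- face.
record Generic (c n : ℕ) (Δ : Complex) (ψ : ℤ → ℤ) (b r : ℕ) (S Q : List ℤ) : Set where
  field
    G F : List ℤ
    G-above : All (λ g → b < ∣ g ∣ × InV n g) G
    G-size : length G ≡ r
    F∈Δ : F ∈ Δ
    S⊆F : map ψ S ⊆ F
    G⊆F : map ψ G ⊆ F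
    G-far : AllPairs (Far c) (map ψ G)
    Q-far : All (λ h → All (Far c h) Q) (map ψ G)

module _ (c : ℕ) {n : ℕ} {ψ : ℤ → ℤ} {Δ : Complex} (Sy : Symmetry n Δ ψ) where
  open Symmetry Sy

  -- Each choice adds one image to `Q` and lowers `r`, so `length Q + r` is constant and a single
  -- `L` serves all rounds.
  select : ∀ {b L} r {S} Q → All (InV n) S → (length Q + r) * (suc (c + c) * 2) < L →
    Extends n Δ b L r S → Generic c n Δ ψ b r S Q
  select zero {S} Q inS lt face with preserves-faces inS face
  ... | F , F∈ , s = record { G = [] ; F = F ; G-above = [] ; G-size = refl ; F∈Δ = F∈ ; S⊆F = s
                            ; G⊆F = λ () ; G-far = [] ; Q-far = [] }
  select {b} {L} (suc r) {S} Q inS lt (w , bw , wL , ext)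
    with avoid Sy (nearAll c Q) w L wL (subst (_< L) (sym (nearAll-length c Q))
           (ℕ.≤-<-trans (ℕ.*-monoˡ-≤ (suc (c + c) * 2) (ℕ.m≤m+n (length Q) (suc r))) lt))
  ... | g , w<g , g≤ , g∉ = record
      { G = + g ∷ R.G ; F = R.F
      ; G-above = (ℕ.≤-<-trans bw w<g , in-g) ∷ R.G-above
      ; G-size = cong suc R.G-size
      ; F∈Δ = R.F∈Δ
      ; S⊆F = R.S⊆F ∘ there
      ; G⊆F = ∷-⊆ (R.S⊆F (here refl)) R.G⊆F
      ; G-far = All.map (λ { (f ∷ _) → swap f }) R.Q-far ∷ R.G-far
      ; Q-far = nearAll-complete c Q g∉ ∷ All.map (λ { (_ ∷ fs) → fs }) R.Q-far
      }
    where
    in-g : InV n (+ g)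
    in-g = ℕ.≤-trans (s≤s z≤n) w<g , ℕ.≤-trans g≤ wL
    module R = Generic (select r (ψ (+ g) ∷ Q) (in-g ∷ inS)
      (subst (λ x → x * (suc (c + c) * 2) < L) (ℕ.+-suc (length Q) r) lt) (ext g w<g g≤))

-- Rigidity of symmetries

IsFace-neg : ∀ d n {σ} → 1 ≤ n → IsFace (Sph d n) σ → IsFace (Sph d n) (negF σ)
IsFace-neg d n l (F , F∈ , s) = let G , G∈ , e = Sph-neg d n l F∈ in G , G∈ , proj₁ e ∘ negF-⊆ s

-- Composing with negation on either side reduces statements about negative vertices to positive
-- ones.
neg∘ : ∀ {d n ψ} → 1 ≤ n → Symmetry n (Sph d n) ψ → Symmetry n (Sph d n) (-_ ∘ ψ)
neg∘ {d} {n} {ψ} l S = record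
  { preserves-V = λ {z} v → neg-InV (ψ z) (preserves-V v)
  ; injective = λ a b e → injective a b (ℤ.neg-injective e)
  ; surjective = λ {w} v → let z , z∈ , e = surjective (neg-InV w v) in z , z∈ , trans (cong -_ e) (ℤ.neg-involutive w)
  ; preserves-faces = λ {σ} a f → subst (IsFace (Sph d n)) (sym (List.map-∘ σ)) (IsFace-neg d n l
      (preserves-faces a f))
  }
  where open Symmetry S

∘neg : ∀ {d n ψ} → 1 ≤ n → Symmetry n (Sph d n) ψ → Symmetry n (Sph d n) (ψ ∘ -_)
∘neg {d} {n} {ψ} l S = record
  { preserves-V = λ {z} v → preserves-V (neg-InV z v)
  ; injective = λ {z} {w} a b e → ℤ.neg-injective (injective (neg-InV z a) (neg-InV w b) e)
  ; surjective = λ {w} v → let z , z∈ , e = surjective v in - z , neg-InV z z∈ , trans (cong ψ (ℤ.neg-involutive z)) e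
  ; preserves-faces = λ {σ} a f → subst (IsFace (Sph d n)) (sym (List.map-∘ σ))
      (preserves-faces (All.map⁺ (All.map (λ {v} → neg-InV v) a)) (IsFace-neg d n l f))
  }
  where open Symmetry S

-- The top of the tower over q gaps of the least admissible size c + 1.
reach : ℕ → ℕ → ℕ
reach c zero = 2
reach c (suc q) = 4 + (reach c q + c)

-- The cost of one more pair: a gap of c + 3 above the previous top, then a window of `L`
-- candidates.
stride : ℕ → ℕ → ℕ
stride c L = 3 + (c + L)

-- A bound for the top of a tower of q + 1 pairs whose upper vertices are chosen from windows, the
-- first among 2, ..., L + 1.
span : ℕ → ℕ → ℕ → ℕ
span q c L = suc L + q * stride c L

-- Either q + 1 strides fit above a vertex, or the vertex is so large that the towers bounded by
-- `span` and `reach` fit more than c below it.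
threshold : ℕ → ℕ → ℕ → ℕ
threshold q c L = suc q * stride c L + (6 + (span q c L + c + reach c q))

-- L is a window length that leaves room to avoid everything not Far from q + 4 given vertices.
module Rigidity (q c L n : ℕ) (lc : ev (2 + q) < c) (lL : (2 + suc q) * (suc (c + c) * 2) < L)
    (dim<n : 3 + ev q < n) where
  open Bounds c
  open Extension c
  open Towers c

  Δ : Complex
  Δ = Sph (3 + ev q) n

  1≤n : 1 ≤ n
  1≤n = ℕ.≤-trans (s≤s z≤n) dim<n

  W : ℕ
  W = stride c L

  -- If `x` and `y` were far, they would give q + 3 far vertices with `H`, against `far-size`. So
  -- |y| ≤ |x| + c, and elements of `H` far from both and not below `x` lie above `y`; then
  -- `forced-succ` applies.
  forced : ∀ {F x y H} → F ∈ Δ → x ∈ F → y ∈ F → H ⊆ F → AllPairs (Far c) H →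
    All (λ h → All (Far c h) (x ∷ y ∷ [])) H → length H ≡ suc q → x ≢ y → ∣ x ∣ ≤ ∣ y ∣ → All
        (λ h → ∣ x ∣ ≤ ∣ h ∣) H → Succ x y
  forced {F} {x} {y} {h ∷ H} F∈ x∈ y∈ s f g len x≢y le above with ∣ x ∣ + c <? ∣ y ∣
  ... | yes l = ⊥-elim (far-size (2 + q) (suc q) n ℕ.≤-refl lc dim<n F∈ (∷-⊆ x∈ (∷-⊆ y∈ s))
        ((inj₁ l ∷ All.map (λ { (a ∷ _ ∷ []) → swap a }) g) ∷ All.map (λ { (_ ∷ a ∷ []) → swap a }) g ∷ f)
        (ℕ.≤-reflexive (cong (λ l → suc (suc l)) (sym len))) (inj₁ (s≤s z≤n)))
  ... | no l = forced-succ (2 + q) (suc q) n ℕ.≤-refl lc dim<n F∈ (∷-⊆ x∈ (∷-⊆ y∈ s)) x≢y le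
        (ℕ.<-≤-trans (ℕ.≤-<-trans (ℕ.m≤m+n ∣ y ∣ c) (All.lookup high (here refl)))
          (All.lookup (proj₂ (Sph-size (3 + ev q) n F∈) dim<n) (s (here refl))))
        f high (ℕ.≤-reflexive (sym len))
    where
    high : All (λ g → ∣ y ∣ + c < ∣ g ∣) (h ∷ H)
    high = All.tabulate λ {v} i → case All.lookup g i of λ
      { (_ ∷ inj₂ b ∷ []) → b
      ; (inj₁ a ∷ inj₁ b ∷ []) → ⊥-elim (ℕ.<⇒≱ (ℕ.≤-<-trans (ℕ.m≤m+n ∣ v ∣ c) a) (All.lookup above i))
      ; (inj₂ a ∷ inj₁ b ∷ []) → ⊥-elim (ℕ.<⇒≱ b (ℕ.≤-trans (ℕ.≮⇒≥ l) (ℕ.+-monoˡ-≤ c (All.lookup above i)))) }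

  -- The chosen vertices become the upper vertices of successive pairs of a tower. `T` holds
  -- vertices outside the tower, and `k` turns the completed tower into a face.
  extends-tower : ∀ r {p t F A b N S T} → Tower p t F A → p + r ≤ suc q → S ⊆ F ++ T → b ≤ t → t + r * W ≤ N → N ≤ n →
    (∀ {t′ F′ A′} → Tower (p + r) t′ F′ A′ → t′ ≤ N → F ⊆ F′ → IsFace Δ (F′ ++ T)) → Extends n Δ b L r S
  extends-tower zero {p} {t} {F} T l s bt tN Nn k =
    IsFace-⊆ s (k (subst (λ i → Tower i t F _) (sym (ℕ.+-identityʳ p)) T) (subst (_≤ _) (ℕ.+-identityʳ t) tN) id)
  extends-tower (suc r) {p} {t} {F} {A} {b} {N} {S} {T} Tw l s bt tN Nn k =
    -- Every g in this window is m + 3 with t + c < m, the gap required by `tower-step`.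
    3 + (t + c) , ℕ.≤-trans bt (ℕ.≤-trans (ℕ.m≤m+n t c) (ℕ.m≤n+m (t + c) 3)) , ℕ.≤-trans wL (ℕ.≤-trans tN Nn) , next
    where
    W-eq : 3 + (t + c) + L ≡ t + W
    W-eq = trans (cong (λ l → 3 + l) (ℕ.+-assoc t c L))
      (sym (trans (ℕ.+-suc t _) (cong suc (trans (ℕ.+-suc t _) (cong suc (ℕ.+-suc t _))))))
    wL : 3 + (t + c) + L ≤ t + suc r * W
    wL = subst (_≤ t + suc r * W) (sym W-eq) (ℕ.+-monoʳ-≤ t (ℕ.m≤m+n W (r * W)))
    next : ∀ g → 3 + (t + c) < g → g ≤ 3 + (t + c) + L → Extends n Δ b L r (+ g ∷ S)
    next (suc (suc (suc m))) (s≤s (s≤s (s≤s gap))) g≤ =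
      extends-tower r {T = T} (tower-step Tw (ℕ.≤-<-trans (ev-mono (s≤s (ℕ.≤-trans (ℕ.m≤m+n (suc p) r) (subst
          (_≤ suc q) (ℕ.+-suc p r) l)))) lc) gap)
        (subst (_≤ suc q) (ℕ.+-suc p r) l)
        (∷-⊆ (here refl) λ i → there (there (s i)))
        (ℕ.≤-trans bt (ℕ.≤-trans (ℕ.m≤m+n t c) (ℕ.≤-trans (ℕ.<⇒≤ gap) (ℕ.m≤n+m m 3))))
        (ℕ.≤-trans (ℕ.+-monoˡ-≤ (r * W) g≤) (subst (_≤ N) (sym (trans (cong (_+ r * W) W-eq) (ℕ.+-assoc t W
            (r * W)))) tN))
        Nn λ {t′} {F′} {A′} T′ t≤ F⊆ → k (subst (λ i → Tower i t′ F′ A′) (sym (ℕ.+-suc p r)) T′) t≤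
            (F⊆ ∘ there ∘ there)

  pair-low : ∀ i {b} → b ≤ 2 + i → 2 + i + suc q * W ≤ n → Extends n Δ b L (suc q) (+ suc i ∷ + (2 + i) ∷ [])
  pair-low i bt l = extends-tower (suc q) {T = []} (tower-base i) ℕ.≤-refl ∈-++⁺ˡ bt l ℕ.≤-refl
    λ T t≤ _ → subst (IsFace Δ) (sym (List.++-identityʳ _)) (∈F⇒IsFace (facet T t≤ dim<n))

  N : ℕ
  N = span q c L

  extends-below : ∀ {S m} → N + c < m → 3 + m ≤ n → (∀ {t F A} → Tower q t F A → t + c < m → IsFace Δ (F ++ S)) →
    Extends n Δ 0 L (suc q) S
  -- Starting after 1 makes the first choice at least 2, the upper vertex of a base pair.
  extends-below {S} {m} Nm mn k = 1 , z≤n , ℕ.≤-trans (ℕ.m≤m+n (suc L) (q * W)) N≤n , first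
    where
    N≤n : N ≤ n
    N≤n = ℕ.≤-trans (ℕ.≤-trans (ℕ.m≤m+n N c) (ℕ.<⇒≤ Nm)) (ℕ.≤-trans (ℕ.m≤n+m m 3) mn)
    first : ∀ g → 1 < g → g ≤ 1 + L → Extends n Δ 0 L q (+ g ∷ S)
    first (suc zero) (s≤s ())
    first (suc (suc i)) _ g≤ = extends-tower q {T = S} (tower-base i) (ℕ.n≤1+n q)
      (∷-⊆ (there (here refl)) (there ∘ there)) z≤n (ℕ.+-monoˡ-≤ (q * W) g≤) N≤n
      λ T t≤ _ → k T (ℕ.≤-<-trans (ℕ.+-monoˡ-≤ c t≤) Nm)

  pair-high : ∀ {m} → N + c < m → 3 + m ≤ n → Extends n Δ 0 L (suc q) (+ (3 + m) ∷ + (1 + m) ∷ [])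
  pair-high {m} Nm mn = extends-below Nm mn λ {t} {F} T gap →
    IsFace-⊆ (rotate F) (∈F⇒IsFace (facet (tower-step T lc gap) mn dim<n))
    where
    rotate : ∀ F → F ++ (+ (3 + m) ∷ + (1 + m) ∷ []) ⊆ + (3 + m) ∷ + (1 + m) ∷ F
    rotate F i with ∈-++⁻ F i
    ... | inj₁ j = there (there j)
    ... | inj₂ (here e) = here e
    ... | inj₂ (there (here e)) = there (here e)

  pair-top : ∀ {m} → N + c < m → 3 + m ≡ n → Extends n Δ 0 L (suc q) (+ (3 + m) ∷ + (2 + m) ∷ [])
  pair-top {m} Nm refl = extends-below Nm ℕ.≤-refl λ {t} {F} T gap →
    IsFace-⊆ (rotate F) (∈F⇒IsFace (tower-cap T lc gap))
    where
    rotate : ∀ F → F ++ (+ (3 + m) ∷ + (2 + m) ∷ []) ⊆ + (3 + m) ∷ + (2 + m) ∷ F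
    rotate F i with ∈-++⁻ F i
    ... | inj₁ j = there (there j)
    ... | inj₂ (here e) = here e
    ... | inj₂ (there (here e)) = there (here e)

  Sym : (ℤ → ℤ) → Set
  Sym = Symmetry n Δ

  -- Taking the images of `x` and `y` as `Q` makes the auxiliary images far from both; 2 + (q + 1)
  -- is the count allowed for by `lL`.
  partner : ∀ {ψ S x y b} → Sym ψ → All (InV n) S → Extends n Δ b L (suc q) S → x ∈ S → y ∈ S →
    ψ x ≢ ψ y → ∣ ψ x ∣ ≤ ∣ ψ y ∣ → (∀ {g} → b < ∣ g ∣ → InV n g → ∣ ψ x ∣ ≤ ∣ ψ g ∣) → Succ (ψ x) (ψ y)
  partner {ψ} {S} {x} {y} Sy inS ext x∈ y∈ x≢y le above = forced F∈Δ (S⊆F (∈-map⁺ ψ x∈)) (S⊆F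
      (∈-map⁺ ψ y∈)) G⊆F G-far Q-far
      (trans (List.length-map ψ G) G-size) x≢y le
      (All.map⁺ (All.map (λ { (a , b) → above a b }) G-above))
    where open Generic (select c Sy (suc q) (ψ x ∷ ψ y ∷ []) inS lL ext)

  Succ-pos : ∀ {i y} → Succ (+ suc i) y → y ≡ + (2 + i)
  Succ-pos succ⁺ = refl

  tower : ∀ r → r ≤ q → ∃[ F ] ∃[ A ] Tower r (reach c r) F A
  tower zero _ = _ , _ , tower-base 0
  tower (suc r) l = let _ , _ , T = tower r (ℕ.<⇒≤ l) in
    _ , _ , tower-step T (ℕ.≤-<-trans (ev-mono (s≤s (s≤s (ℕ.<⇒≤ l)))) lc) ℕ.≤-refl

  Fixes : (ℤ → ℤ) → ℕ → Set
  Fixes ψ j = ∀ {z} → 1 ≤ ∣ z ∣ → ∣ z ∣ ≤ j → ψ z ≡ z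

  module _ {ψ : ℤ → ℤ} (Sy : Sym ψ) where
    open Symmetry Sy

    -- If |ψ z| ≤ j, then ψ z is itself fixed, and injectivity gives ψ z = z.
    Fixes-outside : ∀ {j z} → Fixes ψ j → InV n z → j < ∣ z ∣ → j < ∣ ψ z ∣
    Fixes-outside {j} {z} fix z∈ l with j <? ∣ ψ z ∣
    ... | yes r = r
    ... | no r = ⊥-elim (r (subst (λ w → j < ∣ w ∣) (sym fixed) l))
      where
      fixed : ψ z ≡ z
      fixed = injective (preserves-V z∈) z∈ (fix (proj₁ (preserves-V z∈)) (ℕ.≮⇒≥ r))

    -- By `Fixes-outside` the images of i + 2 and of the auxiliary vertices lie beyond the fixed
    -- vertex i + 1, so `partner` applies to the pair {i + 1, i + 2}.
    fixes-next-low : ∀ i → Fixes ψ (suc i) → 2 + i + suc q * W ≤ n → ψ (+ (2 + i)) ≡ + (2 + i)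
    fixes-next-low i fix l = Succ-pos (subst (λ x → Succ x (ψ (+ (2 + i)))) eq
      (partner Sy (low-in ∷ next-in ∷ []) (pair-low i {b = suc i} (ℕ.n≤1+n _) l) (here refl) (there (here refl))
        (λ e → ℕ.<-irrefl (cong ∣_∣ (trans (sym eq) e)) out)
        (subst (λ x → ∣ x ∣ ≤ ∣ ψ (+ (2 + i)) ∣) (sym eq) (ℕ.<⇒≤ out))
        λ {g} b g∈ → subst (λ x → ∣ x ∣ ≤ ∣ ψ g ∣) (sym eq) (ℕ.<⇒≤ (Fixes-outside fix g∈ b))))
      where
      eq : ψ (+ suc i) ≡ + suc i
      eq = fix (s≤s z≤n) ℕ.≤-refl
      next-in : InV n (+ (2 + i))
      next-in = s≤s z≤n , ℕ.≤-trans (ℕ.m≤m+n (2 + i) (suc q * W)) l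
      low-in : InV n (+ suc i)
      low-in = s≤s z≤n , ℕ.<⇒≤ (proj₂ next-in)
      out : suc i < ∣ ψ (+ (2 + i)) ∣
      out = Fixes-outside fix next-in ℕ.≤-refl

    fixes-next-high : ∀ m → Fixes ψ (2 + m) → 3 + m ≤ n → reach c q + c < m → ψ (+ (3 + m)) ≡ + (3 + m)
    fixes-next-high m fix l gap with tower q ℕ.≤-refl
    ... | F , A , T with preserves-faces {σ = + (1 + m) ∷ + (3 + m) ∷ A} (mid-in ∷ top-in ∷ All.tabulate
        (λ i → A-in i))
                          (IsFace-⊆ sub (∈F⇒IsFace (facet (tower-step T lc gap) l dim<n)))
      where
      top-in : InV n (+ (3 + m))
      top-in = s≤s z≤n , l
      mid-in : InV n (+ (1 + m))
      mid-in = s≤s z≤n , ℕ.<⇒≤ (ℕ.<⇒≤ l)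
      A≤m : ∀ {v} → v ∈ A → ∣ v ∣ ≤ m
      A≤m i = ℕ.≤-trans (All.lookup (bounded T) (A⊆F T i)) (ℕ.≤-trans (ℕ.m≤m+n _ c) (ℕ.<⇒≤ gap))
      A-in : ∀ {v} → v ∈ A → InV n v
      A-in i = ℕ.<⇒≤ (All.lookup (A-big T) i) , ℕ.≤-trans (A≤m i) (ℕ.≤-trans (ℕ.m≤n+m m 3) l)
      sub : + (1 + m) ∷ + (3 + m) ∷ A ⊆ + (3 + m) ∷ + (1 + m) ∷ F
      sub = ∷-⊆ (there (here refl)) (∷-⊆ (here refl) (there ∘ there ∘ A⊆F T))
    ... | Φ , Φ∈ , s = forced-skip q n lc dim<n Φ∈ (subst (_⊆ Φ) image s)
        (Fixes-outside fix (s≤s z≤n , l) ℕ.≤-refl) (A-far T)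
        (All.tabulate (λ i → ℕ.≤-<-trans (ℕ.+-monoˡ-≤ c (All.lookup (bounded T) (A⊆F T i))) (ℕ.<-trans gap
            (ℕ.n<1+n m))))
        (A-big T) (subst (q <_) (sym (A-size T)) ℕ.≤-refl)
      where
      image : map ψ (+ (1 + m) ∷ + (3 + m) ∷ A) ≡ + (1 + m) ∷ ψ (+ (3 + m)) ∷ A
      image = cong₂ _∷_ (fix (s≤s z≤n) (ℕ.n≤1+n _)) (cong (ψ (+ (3 + m)) ∷_) (List.map-id-local
        (All.tabulate λ i → fix (ℕ.<⇒≤ (All.lookup (A-big T) i))
          (ℕ.≤-trans (All.lookup (bounded T) (A⊆F T i)) (ℕ.≤-trans (ℕ.m≤m+n _ c) (ℕ.≤-trans (ℕ.<⇒≤ gap)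
              (ℕ.m≤n+m m 2)))))))

    -- The order conditions of `partner` hold automatically, as 1 is the least absolute value of a
    -- vertex.
    partner-of-one : ∀ {S a y b} → All (InV n) S → Extends n Δ b L (suc q) S → + a ∈ S → y ∈ S → y ≢ + a →
      ψ (+ a) ≡ + 1 → ψ y ≡ + 2
    partner-of-one {a = a} {y} inS ext a∈ y∈ y≢a eq = Succ-pos (subst (λ x → Succ x (ψ y)) eq
      (partner Sy inS ext a∈ y∈ (λ e → y≢a (sym (injective (All.lookup inS a∈) (All.lookup inS y∈) e)))
        (subst (λ x → ∣ x ∣ ≤ ∣ ψ y ∣) (sym eq) (proj₁ (preserves-V (All.lookup inS y∈))))
        λ {g} _ g∈ → subst (λ x → ∣ x ∣ ≤ ∣ ψ g ∣) (sym eq) (proj₁ (preserves-V g∈))))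

  module _ (room : threshold q c L ≤ n) where

    high : ∀ a → ¬ (suc a + suc q * W ≤ n) → 6 + (N + c + reach c q) ≤ a
    high a l = ℕ.+-cancelˡ-≤ (suc q * W) _ _ (ℕ.≤-trans room
      (subst (n ≤_) (ℕ.+-comm a (suc q * W)) (ℕ.≤-pred (ℕ.≰⇒> l))))

    -- If a > 1, two different partners of a would both be sent to 2. With room above these are a -
    -- 1 and a + 1. Otherwise one is a - 2 and the other is a + 2, or a + 1 if a = n - 1, or a - 1
    -- if a = n.
    one-preimage : ∀ {ψ a} → Sym ψ → InV n (+ a) → ψ (+ a) ≡ + 1 → a ≡ 1
    one-preimage {a = zero} Sy (() , _) eq
    one-preimage {a = suc zero} Sy a∈ eq = refl
    one-preimage {ψ} {a = suc (suc i)} Sy a∈ eq with suc (2 + i) + suc q * W ≤? n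
    ... | yes l = case Symmetry.injective Sy prev-in next-in (trans
          (partner-of-one Sy (prev-in ∷ a∈ ∷ []) (pair-low i {b = 0} z≤n (ℕ.<⇒≤ l)) (there (here refl))
              (here refl) (λ ()) eq)
          (sym (partner-of-one Sy (a∈ ∷ next-in ∷ []) (pair-low (suc i) {b = 0} z≤n l) (here refl) (there
              (here refl)) (λ ()) eq)))
          of λ ()
      where
      prev-in : InV n (+ suc i)
      prev-in = s≤s z≤n , ℕ.<⇒≤ (proj₂ a∈)
      next-in : InV n (+ (3 + i))
      next-in = s≤s z≤n , ℕ.≤-trans (ℕ.m≤m+n (3 + i) _) l
    one-preimage {ψ} {a = suc (suc i)} Sy a∈ eq | no l with high (2 + i) l
    one-preimage {ψ} {a = suc (suc (suc m))} Sy a∈ eq | no l | s≤s (s≤s (s≤s h)) = clash (ℕ.m≤n⇒m<n∨m≡n (proj₂ a∈))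
      where
      gap : N + c < m
      gap = ℕ.<-≤-trans (s≤s (ℕ.≤-trans (ℕ.m≤m+n (N + c) (reach c q)) (ℕ.m≤n+m _ 2))) h
      prev-in : InV n (+ (1 + m))
      prev-in = s≤s z≤n , ℕ.≤-trans (ℕ.m≤n+m (1 + m) 2) (proj₂ a∈)
      prev : ψ (+ (1 + m)) ≡ + 2
      prev = partner-of-one Sy (a∈ ∷ prev-in ∷ []) (pair-high gap (proj₂ a∈)) (here refl) (there (here refl)) (λ
          ()) eq
      clash : 3 + m < n ⊎ 3 + m ≡ n → _
      clash (inj₂ e) = case Symmetry.injective Sy prev-in y-in (trans prev (sym
          (partner-of-one Sy (a∈ ∷ y-in ∷ []) (pair-top gap e) (here refl) (there (here refl)) (λ ()) eq))) of λ ()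
        where
        y-in : InV n (+ (2 + m))
        y-in = s≤s z≤n , ℕ.<⇒≤ (proj₂ a∈)
      clash (inj₁ l₄) with ℕ.m≤n⇒m<n∨m≡n l₄
      ... | inj₁ l₅ = case Symmetry.injective Sy prev-in (s≤s z≤n , l₅) (trans prev (sym
          (partner-of-one Sy ((s≤s z≤n , l₅) ∷ a∈ ∷ []) (pair-high {2 + m} (ℕ.<-≤-trans gap (ℕ.m≤n+m m 2)) l₅)
            (there (here refl)) (here refl) (λ ()) eq))) of λ ()
      ... | inj₂ e = case Symmetry.injective Sy prev-in (s≤s z≤n , l₄) (trans prev (sym
          (partner-of-one Sy ((s≤s z≤n , l₄) ∷ a∈ ∷ []) (pair-top {1 + m} (ℕ.<-≤-trans gap (ℕ.n≤1+n m)) e)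
            (there (here refl)) (here refl) (λ ()) eq))) of λ ()

    fixes-next : ∀ {ψ j} → Sym ψ → Fixes ψ (suc j) → 2 + j ≤ n → ψ (+ (2 + j)) ≡ + (2 + j)
    fixes-next {ψ} {j} Sy fix l with 2 + j + suc q * W ≤? n
    ... | yes l′ = fixes-next-low Sy j fix l′
    ... | no l′ with high (suc j) l′
    fixes-next {ψ} {suc m} Sy fix l | no l′ | s≤s (s≤s h) = fixes-next-high Sy m fix l
      (ℕ.<-≤-trans (s≤s (ℕ.≤-trans (ℕ.≤-reflexive (ℕ.+-comm (reach c q) c)) (ℕ.≤-trans (ℕ.+-monoˡ-≤ (reach c q)
          (ℕ.m≤n+m c N)) (ℕ.m≤n+m _ 3)))) h)

    fixes-all : ∀ {ψ} → Sym ψ → Fixes ψ 1 → ∀ j → suc j ≤ n → Fixes ψ (suc j)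
    fixes-all Sy fix zero l = fix
    fixes-all {ψ} Sy fix (suc j) l {z} z≥ z≤ with ℕ.m≤n⇒m<n∨m≡n z≤
    ... | inj₁ z< = fixes-all Sy fix j (ℕ.<⇒≤ l) z≥ (ℕ.≤-pred z<)
    fixes-all {ψ} Sy fix (suc j) l {+ _} z≥ z≤ | inj₂ refl = fixes-next Sy (fixes-all Sy fix j (ℕ.<⇒≤ l)) l
    -- Conjugating `ψ` by negation gives a symmetry with the same fixed range, to which the positive
    -- case applies.
    fixes-all {ψ} Sy fix (suc j) l { -[1+ _ ]} z≥ z≤ | inj₂ refl = trans (sym (ℤ.neg-involutive _)) (cong -_
      (fixes-next (neg∘ {3 + ev q} 1≤n (∘neg {3 + ev q} 1≤n Sy)) (λ {z} a b → trans (cong -_ (fixes-all Sy fix j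
          (ℕ.<⇒≤ l)
          (subst (1 ≤_) (sym (ℤ.∣-i∣≡∣i∣ z)) a) (subst (_≤ suc j) (sym (ℤ.∣-i∣≡∣i∣ z)) b))) (ℤ.neg-involutive z)) l))

    one-preimage-± : ∀ {ψ z} → Sym ψ → InV n z → ψ z ≡ + 1 → ∣ z ∣ ≡ 1
    one-preimage-± {z = + a} Sy z∈ eq = one-preimage Sy z∈ eq
    one-preimage-± {z = -[1+ a ]} Sy z∈ eq = one-preimage (∘neg {3 + ev q} 1≤n Sy) z∈ eq

    -- The preimage of -1 is 1 or -1 by `one-preimage-±` for the negated symmetry, and it is not 1,
    -- whose image is 1.
    fixes-one⇒fixes : ∀ {ψ} → Sym ψ → ψ (+ 1) ≡ + 1 → Fixes ψ n
    fixes-one⇒fixes {ψ} Sy eq with Symmetry.surjective Sy { -[1+ 0 ]} (s≤s z≤n , 1≤n)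
    ... | z , z∈ , e with one-preimage-± (neg∘ {3 + ev q} 1≤n Sy) z∈ (cong -_ e)
    fixes-one⇒fixes {ψ} Sy eq | + .1 , z∈ , e | refl = case trans (sym eq) e of λ ()
    fixes-one⇒fixes {ψ} Sy eq | -[1+ .0 ] , z∈ , e | refl = λ a b → fixes-all Sy one _ (subst (_≤ n) (sym
        (ℕ.m+[n∸m]≡n a)) b) a (ℕ.≤-reflexive (sym (ℕ.m+[n∸m]≡n a)))
      where
      one : Fixes ψ 1
      one {+ 1} _ _ = eq
      one { -[1+ 0 ]} _ _ = e
      one {+ 0} () _
      one {+ (suc (suc _))} _ (s≤s ())
      one { -[1+ suc _ ]} _ (s≤s ())

    -- The preimage of 1 is 1 or -1; in the second case `ψ` preceded by negation fixes 1.
    rigidity : ∀ {ψ} → Sym ψ → (∀ {z} → InV n z → ψ z ≡ z) ⊎ (∀ {z} → InV n z → ψ z ≡ - z)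
    rigidity {ψ} Sy with Symmetry.surjective Sy {+ 1} (s≤s z≤n , 1≤n)
    ... | z , z∈ , e with one-preimage-± Sy z∈ e
    rigidity {ψ} Sy | + .1 , z∈ , e | refl = inj₁ λ { (a , b) → fixes-one⇒fixes Sy e a b }
    rigidity {ψ} Sy | -[1+ .0 ] , z∈ , e | refl = inj₂ λ {z} (a , b) → trans (cong ψ (sym (ℤ.neg-involutive z)))
      (fixes-one⇒fixes (∘neg {3 + ev q} 1≤n Sy) e (subst (1 ≤_) (sym (ℤ.∣-i∣≡∣i∣ z)) a) (subst (_≤ n) (sym
          (ℤ.∣-i∣≡∣i∣ z)) b))

-- Automorphisms as maps of integers

toℤ-neg : ∀ {n} (v : V n) → toℤ (negV v) ≡ - toℤ v
toℤ-neg (j , true) = refl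
toℤ-neg (j , false) = refl

negV-involutive : ∀ {n} (v : V n) → negV (negV v) ≡ v
negV-involutive (j , true) = refl
negV-involutive (j , false) = refl

toℤ-injective : ∀ {n} {v w : V n} → toℤ v ≡ toℤ w → v ≡ w
toℤ-injective {v = i , true} {j , true} e = cong (_, true) (Fin.toℕ-injective (ℕ.suc-injective (ℤ.+-injective e)))
toℤ-injective {v = i , false} {j , false} e = cong (_, false) (Fin.toℕ-injective (ℤ.-[1+-injective e))

toℤ-InV : ∀ {n} (v : V n) → InV n (toℤ v)
toℤ-InV (j , true) = s≤s z≤n , Fin.toℕ<n j
toℤ-InV (j , false) = s≤s z≤n , Fin.toℕ<n j

InV⇒toℤ : ∀ {n} z → InV n z → ∃[ v ] toℤ {n} v ≡ z
InV⇒toℤ (+ suc j) (_ , l) = (fromℕ< l , true) , cong (λ i → + suc i) (Fin.toℕ-fromℕ< l)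
InV⇒toℤ -[1+ j ] (_ , l) = (fromℕ< l , false) , cong -[1+_] (Fin.toℕ-fromℕ< l)

-- Integers that are not vertices are sent to themselves; this default lies outside the range of
-- `InV`.
onℤ : ∀ {n} → (V n → V n) → ℤ → ℤ
onℤ φ (+ zero) = + zero
onℤ {n} φ (+ suc j) with j <? n
... | yes l = toℤ (φ (fromℕ< l , true))
... | no _ = + suc j
onℤ {n} φ -[1+ j ] with j <? n
... | yes l = toℤ (φ (fromℕ< l , false))
... | no _ = -[1+ j ]

onℤ-toℤ : ∀ {n} (φ : V n → V n) v → onℤ φ (toℤ v) ≡ toℤ (φ v)
onℤ-toℤ {n} φ (j , true) with toℕ j <? n
... | yes l = cong (λ i → toℤ (φ (i , true))) (Fin.fromℕ<-toℕ j l)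
... | no l = ⊥-elim (l (Fin.toℕ<n j))
onℤ-toℤ {n} φ (j , false) with toℕ j <? n
... | yes l = cong (λ i → toℤ (φ (i , false))) (Fin.fromℕ<-toℕ j l)
... | no l = ⊥-elim (l (Fin.toℕ<n j))

∈C⇒IsFace : ∀ {σ Δ} → σ ∈C Δ → IsFace Δ σ
∈C⇒IsFace i = let F , F∈ , s = find i in F , F∈ , All.lookup s

IsFace⇒∈C : ∀ {σ Δ} → IsFace Δ σ → σ ∈C Δ
IsFace⇒∈C (F , F∈ , s) = lose F∈ (All.tabulate s)

automorphism⇒symmetry : ∀ {n Δ φ} → IsAutomorphism n Δ φ → Symmetry n Δ (onℤ φ)
automorphism⇒symmetry {n} {Δ} {φ} ((inj , surj) , faces) = record
  { preserves-V = λ {z} z∈ → case InV⇒toℤ z z∈ of λ { (v , refl) → subst (InV n) (sym (onℤ-toℤ φ v)) (toℤ-InV (φ v)) }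
  ; injective = λ {z} {w} z∈ w∈ e → case (InV⇒toℤ z z∈ , InV⇒toℤ w w∈) of λ
      { ((v , refl) , (u , refl)) → cong toℤ (inj (toℤ-injective (trans (sym (onℤ-toℤ φ v)) (trans e
          (onℤ-toℤ φ u))))) }
  ; surjective = λ {w} w∈ → case InV⇒toℤ w w∈ of λ
      { (u , refl) → let v , e = surj u in toℤ v , toℤ-InV v , trans (onℤ-toℤ φ v) (cong toℤ (e refl)) }
  ; preserves-faces = λ {σ} σ∈ f → case lift σ σ∈ of λ
      { (τ , refl) → subst (IsFace Δ) (trans (List.map-cong (λ v → sym (onℤ-toℤ φ v)) τ) (List.map-∘ τ))
          (∈C⇒IsFace (Equivalence.to (faces τ) (IsFace⇒∈C f))) }
  }
  where
  lift : ∀ σ → All (InV n) σ → ∃[ τ ] map (toℤ {n}) τ ≡ σ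
  lift [] [] = [] , refl
  lift (z ∷ σ) (z∈ ∷ σ∈) = let v , e = InV⇒toℤ z z∈ ; τ , e′ = lift σ σ∈ in v ∷ τ , cong₂ _∷_ e e′

id-automorphism : ∀ n Δ → IsAutomorphism n Δ id
id-automorphism n Δ = (id , λ y → y , id) , λ σ → mk⇔ id id

negV-automorphism : ∀ d n → 1 ≤ n → IsAutomorphism n (Sph d n) negV
negV-automorphism d n l = (inj , λ y → negV y , λ { refl → negV-involutive y }) , λ σ → mk⇔ (to σ) (from σ)
  where
  inj : ∀ {v w : V n} → negV v ≡ negV w → v ≡ w
  inj {v} {w} e = trans (sym (negV-involutive v)) (trans (cong negV e) (negV-involutive w))
  map-neg : ∀ (σ : List (V n)) → map (toℤ ∘ negV) σ ≡ negF (map toℤ σ)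
  map-neg σ = trans (List.map-cong toℤ-neg σ) (List.map-∘ σ)
  to : ∀ (σ : List (V n)) → map toℤ σ ∈C Sph d n → map (toℤ ∘ negV) σ ∈C Sph d n
  to σ f = IsFace⇒∈C (subst (IsFace (Sph d n)) (sym (map-neg σ)) (IsFace-neg d n l (∈C⇒IsFace f)))
  from : ∀ (σ : List (V n)) → map (toℤ ∘ negV) σ ∈C Sph d n → map toℤ σ ∈C Sph d n
  from σ f = IsFace⇒∈C (subst (IsFace (Sph d n)) (negF-involutive (map toℤ σ))
    (IsFace-neg d n l (subst (IsFace (Sph d n)) (map-neg σ) (∈C⇒IsFace f))))

-- The theorem for k = q + 2

ev≡+ : ∀ q → ev q ≡ q + q
ev≡+ zero = refl
ev≡+ (suc q) = cong suc (trans (cong suc (ev≡+ q)) (sym (ℕ.+-suc q q)))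

dimension : ∀ q → 2 * (2 + q) ∸ 1 ≡ 3 + ev q
dimension q = begin
  suc (q + (2 + (q + 0)))  ≡⟨ cong (λ x → suc (q + (2 + x))) (ℕ.+-identityʳ q) ⟩
  suc (q + (2 + q))        ≡⟨ cong suc (trans (ℕ.+-suc q (suc q)) (cong suc (ℕ.+-suc q q))) ⟩
  3 + (q + q)              ≡⟨ cong (λ x → 3 + x) (sym (ev≡+ q)) ⟩
  3 + ev q                 ∎
  where open ≡-Reasoning

theorem6p1 : (k : ℕ) → 2 ≤ k →
    ∃[ N ] ((n : ℕ) → N ≤ n →
    IsAutomorphism n (Sph (2 * k ∸ 1) n) id
    × IsAutomorphism n (Sph (2 * k ∸ 1) n) negV
    × ((φ : V n → V n) → IsAutomorphism n (Sph (2 * k ∸ 1) n) φ →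
    ((v : V n) → φ v ≡ v) ⊎ ((v : V n) → φ v ≡ negV v)))
theorem6p1 (suc zero) (s≤s ())
theorem6p1 (suc (suc q)) _ = (4 + ev q) + threshold q c L , λ n l →
  id-automorphism n _ ,
  negV-automorphism (2 * (2 + q) ∸ 1) n (ℕ.≤-trans (s≤s z≤n) l) ,
  λ φ aut → case rigid n l (automorphism⇒symmetry (subst (λ d → IsAutomorphism n (Sph d n) φ) (dimension q) aut)) of λ
    { (inj₁ f) → inj₁ λ v → toℤ-injective (trans (sym (onℤ-toℤ φ v)) (f (toℤ-InV v)))
    ; (inj₂ f) → inj₂ λ v → toℤ-injective (trans (sym (onℤ-toℤ φ v)) (trans (f (toℤ-InV v)) (sym (toℤ-neg v)))) }
  where
  c L : ℕ
  -- The least values with `ev (2 + q) < c` and with `L` above the number of vertices to avoid.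
  c = suc (ev (2 + q))
  L = suc ((2 + suc q) * (suc (c + c) * 2))
  rigid : ∀ n → (4 + ev q) + threshold q c L ≤ n → ∀ {ψ} → Symmetry n (Sph (3 + ev q) n) ψ →
    (∀ {z} → InV n z → ψ z ≡ z) ⊎ (∀ {z} → InV n z → ψ z ≡ - z)
  rigid n l = Rigidity.rigidity q c L n ℕ.≤-refl ℕ.≤-refl (ℕ.≤-trans (ℕ.m≤m+n (4 + ev q) _) l)
    (ℕ.≤-trans (ℕ.m≤n+m _ (4 + ev q)) l)
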